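{- Let $n\ge 2$, $1\le k\le \lfloor n/2\rfloor$ and $1\le r\le n-1$ be integers. Let $\beta_{r,k,n}$ be the rank of the rational Chow cohomology group $A^r(X_{k,n})$, equivalently the dimension of the $\mathbb{Q}$-vector space $\mathcal{M}_r$ of rational Minkowski weights on codimension-$r$ cones of the normal fan of $\Delta_{k,n}$ (defined in the context). Then \[ \beta_{r,k,n}=\begin{cases}\sum_{i=0}^{r-1}\binom{n}{i} & \text{if } 1\le r\le k,\\[2pt] \sum_{i=0}^{k-1}\binom{n}{i} & \text{if } k<r<n-k,\\[2pt] \sum_{i=0}^{n-r-1}\binom{n}{i} & \text{if } n-k\le r\le n-1.\end{cases} \] Moreover, a $\mathbb{Q}$-basis of $\mathcal{M}_r$ is given by the functions $c^{r,k,n}_S$, where $S$ runs over all subsets of $\{1,\dots,n\}$ of size at most $r-1$, $k-1$, and $n-r-1$ in the three cases respectively, and $c^{r,k,n}_S$ is defined on pairs $(I,J)$ in $\mathcal{P}_r$ by \[ c^{r,k,n}_S(I,J)=\begin{cases}1 & \text{if } S\subseteq I\cup J \text{ and } |J\cap S|=\ell^{r,k,n}(I,J),\\ 0 & \text{otherwise.}\end{cases} \]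
   Context: The hypersimplex $\Delta_{k,n}$ is the convex hull of all $0/1$-vectors in $\mathbb{R}^n$ with exactly $k$ ones; $X_{k,n}$ is the complex projective toric variety of its normal fan. The codimension-$r$ cones of the normal fan of $\Delta_{k,n}$ are indexed by the set $\mathcal{P}_r$ of ordered pairs $(I,J)$ of disjoint subsets of $\{1,\dots,n\}$ with $|I|+|J|=n-r-1$, $|I|<k$ and $|J|<n-k$. The level $\ell^{r,k,n}(I,J)$ of $(I,J)\in\mathcal{P}_r$ is $m-|I|$, where $m$ is the maximum of $|I'|$ over all $(I',J')\in\mathcal{P}_r$. By Fulton–Sturmfels, $A^r(X_{k,n})\otimes\mathbb{Q}$ is naturally isomorphic to the space $\mathcal{M}_r$ of Minkowski weights on codimension-$r$ cones, which here are the functions $c:\mathcal{P}_r\to\mathbb{Q}$ satisfying the balancing conditions: (i) $c(A\cup\{x\},B)-c(A\cup\{y\},B)=c(A,B\cup\{x\})-c(A,B\cup\{y\})$ whenever these four pairs lie in $\mathcal{P}_r$ (with $A,B,\{x\},\{y\}$ pairwise disjoint), $|A|<k-1$ and $|B|<n-k-1$; (ii) $c(I,J)=c(I,J')$ whenever $(I,J),(I,J')\in\mathcal{P}_r$ and $|I|=k-1$; (iii) $c(I,J)=c(I',J)$ whenever $(I,J),(I',J)\in\mathcal{P}_r$ and $|J|=n-k-1$. -}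

module Defs where

open import Data.Nat using (ℕ; zero; suc; _+_; _∸_; _≤_; _<_; _⊔_; _≤?_; _<?_; _≤ᵇ_; _<ᵇ_)
open import Data.Nat.Combinatorics using (_C_)
import Data.Nat.Properties as ℕP
open import Data.Bool using (Bool; true; false; if_then_else_; _∧_)
import Data.Bool.Properties as BP
open import Data.Fin using (Fin)
open import Data.Fin.Subset using (Subset; inside; outside; _∩_; _∪_; _⊆_; ∣_∣; ⁅_⁆; _∈_; _∉_) renaming (⊥ to ∅)
open import Data.Fin.Subset.Properties using (_⊆?_)
open import Data.Vec using (Vec; []; _∷_)
open import Data.Vec.Properties using (≡-dec)
open import Data.List using (List; []; _∷_; map; _++_; filter; foldr; upTo; cartesianProduct)
open import Data.Product using (_×_; _,_; proj₁; proj₂)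
open import Data.Rational using (ℚ; 0ℚ; 1ℚ; _*_) renaming (_+_ to _+ℚ_; _-_ to _-ℚ_)
open import Relation.Binary.PropositionalEquality using (_≡_)
open import Relation.Nullary using (Dec; does; ¬_)
open import Relation.Nullary.Decidable using (_×-dec_)

_≟S_ : {n : ℕ} → (A B : Subset n) → Dec (A ≡ B)
_≟S_ = ≡-dec BP._≟_

Disjoint : {n : ℕ} → Subset n → Subset n → Set
Disjoint I J = I ∩ J ≡ ∅

InP : (r k n : ℕ) → Subset n → Subset n → Set
InP r k n I J =
  Disjoint I J × (∣ I ∣ + ∣ J ∣ ≡ n ∸ r ∸ 1) × (∣ I ∣ < k) × (∣ J ∣ < n ∸ k)

InP? : (r k n : ℕ) → (I J : Subset n) → Dec (InP r k n I J)
InP? r k n I J =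
  ((I ∩ J) ≟S ∅) ×-dec ((∣ I ∣ + ∣ J ∣) ℕP.≟ (n ∸ r ∸ 1)) ×-dec (∣ I ∣ <? k) ×-dec (∣ J ∣ <? n ∸ k)

allSubsets : (n : ℕ) → List (Subset n)
allSubsets zero = [] ∷ []
allSubsets (suc n) = map (outside ∷_) (allSubsets n) ++ map (inside ∷_) (allSubsets n)

-- m = max { |I'| : (I',J') ∈ 𝒫_r }  (0 if 𝒫_r is empty).
maxI : (r k n : ℕ) → ℕ
maxI r k n =
  foldr _⊔_ 0
    (map (λ p → ∣ proj₁ p ∣)
      (filter (λ p → InP? r k n (proj₁ p) (proj₂ p))
        (cartesianProduct (allSubsets n) (allSubsets n))))

level : (r k n : ℕ) → Subset n → Subset n → ℕ
level r k n I J = maxI r k n ∸ ∣ I ∣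

-- Rational-valued functions on pairs (only their values on 𝒫_r matter).
Weight : ℕ → Set
Weight n = Subset n → Subset n → ℚ

IsMinkowskiWeight : (r k n : ℕ) → Weight n → Set
IsMinkowskiWeight r k n c =
  (∀ (A B : Subset n) (x y : Fin n) →
     Disjoint A B → x ∉ A → x ∉ B → y ∉ A → y ∉ B → ¬ (x ≡ y) →
     InP r k n (A ∪ ⁅ x ⁆) B → InP r k n (A ∪ ⁅ y ⁆) B →
     InP r k n A (B ∪ ⁅ x ⁆) → InP r k n A (B ∪ ⁅ y ⁆) →
     ∣ A ∣ < k ∸ 1 → ∣ B ∣ < n ∸ k ∸ 1 →
     c (A ∪ ⁅ x ⁆) B -ℚ c (A ∪ ⁅ y ⁆) B ≡ c A (B ∪ ⁅ x ⁆) -ℚ c A (B ∪ ⁅ y ⁆))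
  × (∀ (I J J′ : Subset n) → InP r k n I J → InP r k n I J′ →
       ∣ I ∣ ≡ k ∸ 1 → c I J ≡ c I J′)
  × (∀ (I I′ J : Subset n) → InP r k n I J → InP r k n I′ J →
       ∣ J ∣ ≡ n ∸ k ∸ 1 → c I J ≡ c I′ J)

cS : (r k n : ℕ) → Subset n → Weight n
cS r k n S I J =
  if does (S ⊆? (I ∪ J)) ∧ does (∣ J ∩ S ∣ ℕP.≟ level r k n I J) then 1ℚ else 0ℚ

sizeBound : (r k n : ℕ) → ℕ
sizeBound r k n =
  if r ≤ᵇ k then r ∸ 1 else (if r <ᵇ n ∸ k then k ∸ 1 else n ∸ r ∸ 1)

binomSum : (n b : ℕ) → ℕ
binomSum n b = foldr (λ i acc → (n C i) + acc) 0 (upTo (suc b))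

basisIndex : (n b : ℕ) → List (Subset n)
basisIndex n b = filter (λ S → ∣ S ∣ ≤? b) (allSubsets n)

sumℚ : {A : Set} → (A → ℚ) → List A → ℚ
sumℚ f = foldr (λ a acc → f a +ℚ acc) 0ℚ

linComb : (r k n : ℕ) → List (Subset n) → (Subset n → ℚ) → Weight n
linComb r k n L a I J = sumℚ (λ S → a S * cS r k n S I J) L

-- Two weights agree on 𝒫_r (equality in 𝓜_r).
EqOnP : (r k n : ℕ) → Weight n → Weight n → Set
EqOnP r k n c d = ∀ (I J : Subset n) → InP r k n I J → c I J ≡ d I J

IsBasis : (r k n : ℕ) → List (Subset n) → Set
IsBasis r k n L =
  (∀ S → S Data.List.Membership.Propositional.∈ L → IsMinkowskiWeight r k n (cS r k n S))
  × (∀ (a : Subset n → ℚ) → EqOnP r k n (linComb r k n L a) (λ _ _ → 0ℚ) →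
       ∀ S → S Data.List.Membership.Propositional.∈ L → a S ≡ 0ℚ)
  × (∀ (c : Weight n) → IsMinkowskiWeight r k n c →
       Data.Product.Σ (Subset n → ℚ) (λ a → EqOnP r k n c (linComb r k n L a)))
  where import Data.List.Membership.Propositional

{-# OPTIONS --safe #-}

-- A disjoint pair (I, J) is a word over {i, j, o}, with o marking the positions outside I ∪ J.
-- Put s = n - r - 1, m = max |I|, q = s - m and L = sizeBound.  On 𝒫_r the function c_S becomes
-- χ_q(S) = [S ⊆ I ∪ J] [|J \ S| = q], and 𝒫_r becomes the set of words with r + 1 letters o and
-- q ≤ |J| ≤ q + L.  A weight, extended by 0 to all words with r + 1 letters o, satisfies the
-- balancing equation (i) everywhere: conditions (ii) and (iii) are its cases where two of the
-- four terms lie outside 𝒫_r.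
--
-- Spanning and independence of the χ_q(S), |S| < M = L + 1, are both shown by induction on n,
-- splitting on the first letter; t counts the letters o.
-- * If q = 0, then χ_0(S)(j w) vanishes unless the first element is in S, so the words j w
--   determine the coefficients of S ∋ 1, the words o w those of S ∌ 1, and the balancing
--   equation determines a weight on the words i w from its values on the other two kinds
--   (for t = 0 there are no words o w, and the words i w give the coefficients of S ∌ 1).
-- * If q > 0, the words j w give the case (q - 1, M, t).  What is left after subtracting its
--   solution vanishes on the words o w with |J| = q, which leaves the case (q + 1, M - 1, t - 1).
--   The new family χ_{q+1}(S) lies in the span of the old one because
--   (q + 1) χ_{q+1}(S) + |I \ S| χ_q(S) = ∑_{x ∉ S} χ_q(S ∪ {x}),
--   where |I \ S| = n - t - |S| - q is constant on the support of χ_q(S).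

module Submission where

open import Defs
open import Data.Nat using (ℕ; _≤_; _∸_)
open import Data.Nat.DivMod using (_/_)
open import Data.List using (length)
open import Data.Product using (_×_)
open import Relation.Binary.PropositionalEquality using (_≡_)

import Algebra.Properties.CommutativeSemigroup
import Algebra.Properties.Group
open import Data.Bool using (Bool; true; false; if_then_else_; _∧_)
import Data.Bool.Properties as BP
open import Data.Fin using (Fin; zero; suc)
import Data.Fin.Properties as FP
open import Data.Fin.Subset using (Subset; inside; outside; ∣_∣; _∪_; _∩_; ⁅_⁆; _∉_)
import Data.Fin.Subset.Properties as SP
open SP using (_⊆?_)
open import Data.List using ([]; _∷_; map; filter; _++_; foldr; upTo; applyUpTo; cartesianProduct)
open import Data.List.Membership.Propositional using () renaming (_∈_ to _∈ₗ_)
import Data.List.Membership.Propositional.Properties as LM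
import Data.List.Properties as LP
import Data.List.Relation.Unary.All as All
import Data.List.Relation.Unary.All.Properties as AllP
import Data.List.Relation.Unary.Any as Any
open import Data.Nat as ℕ using (zero; suc; z≤n; s≤s; s<s; z<s)
open import Data.Nat.Combinatorics using (_C_; nCk+nC[k+1]≡[n+1]C[k+1]; k>n⇒nCk≡0)
open import Data.Nat.DivMod using (m/n*n≤m)
import Data.Nat.Properties as ℕP
open import Data.Product using (_,_; proj₁; proj₂; ∃; ∃₂)
open import Data.Rational as ℚ using (ℚ; 0ℚ; 1ℚ; _+_; _*_; -_; _-_; 1/_)
import Data.Rational.Properties as ℚP
open import Data.Rational.Solver using (module +-*-Solver)
open import Data.Sum as Sum using (_⊎_; inj₁; inj₂)
open import Data.Vec using (Vec; []; _∷_; lookup; _[_]≔_; here; there)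
import Data.Vec.Properties as VP
open import Function using (_∘_; mk⇔)
open import Relation.Binary.PropositionalEquality
  using (refl; sym; trans; cong; cong₂; subst; subst₂; module ≡-Reasoning)
open import Relation.Nullary using (Dec; does; ¬_; contradiction; yes; no; ofʸ; ofⁿ)
open import Relation.Nullary.Decidable using (_×-dec_; dec-false; dec-true; does-⇔)

module ℕCS = Algebra.Properties.CommutativeSemigroup ℕP.+-commutativeSemigroup
module ℚG = Algebra.Properties.Group ℚP.+-0-group
open +-*-Solver
open ≡-Reasoning

-- Words

data Letter : Set where
  i j o : Letter

Word : ℕ → Set
Word = Vec Letter

#o : ∀ {n} → Word n → ℕ
#o []      = 0
#o (i ∷ w) = #o w
#o (j ∷ w) = #o w
#o (o ∷ w) = suc (#o w)

#j : ∀ {n} → Word n → ℕ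
#j []      = 0
#j (i ∷ w) = #j w
#j (j ∷ w) = suc (#j w)
#j (o ∷ w) = #j w

-- χ S w q = [S ∩ O = ∅] [|J \ S| = q].
χ : ∀ {n} → Subset n → Word n → ℕ → ℚ
χ []            []      zero    = 1ℚ
χ []            []      (suc q) = 0ℚ
χ (outside ∷ S) (i ∷ w) q       = χ S w q
χ (inside ∷ S)  (i ∷ w) q       = χ S w q
χ (outside ∷ S) (j ∷ w) zero    = 0ℚ
χ (outside ∷ S) (j ∷ w) (suc q) = χ S w q
χ (inside ∷ S)  (j ∷ w) q       = χ S w q
χ (outside ∷ S) (o ∷ w) q       = χ S w q
χ (inside ∷ S)  (o ∷ w) q       = 0ℚ

#o-≔i : ∀ {n} (w : Word n) x → lookup w x ≡ o → suc (#o (w [ x ]≔ i)) ≡ #o w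
#o-≔i (.o ∷ w) zero refl = refl
#o-≔i (i ∷ w) (suc x) e = #o-≔i w x e
#o-≔i (j ∷ w) (suc x) e = #o-≔i w x e
#o-≔i (o ∷ w) (suc x) e = cong suc (#o-≔i w x e)

#o-≔j : ∀ {n} (w : Word n) x → lookup w x ≡ o → suc (#o (w [ x ]≔ j)) ≡ #o w
#o-≔j (.o ∷ w) zero refl = refl
#o-≔j (i ∷ w) (suc x) e = #o-≔j w x e
#o-≔j (j ∷ w) (suc x) e = #o-≔j w x e
#o-≔j (o ∷ w) (suc x) e = cong suc (#o-≔j w x e)

#j-≔i : ∀ {n} (w : Word n) x → lookup w x ≡ o → #j (w [ x ]≔ i) ≡ #j w
#j-≔i (.o ∷ w) zero refl = refl
#j-≔i (i ∷ w) (suc x) e = #j-≔i w x e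
#j-≔i (j ∷ w) (suc x) e = cong suc (#j-≔i w x e)
#j-≔i (o ∷ w) (suc x) e = #j-≔i w x e

#j-≔j : ∀ {n} (w : Word n) x → lookup w x ≡ o → #j (w [ x ]≔ j) ≡ suc (#j w)
#j-≔j (.o ∷ w) zero refl = refl
#j-≔j (i ∷ w) (suc x) e = #j-≔j w x e
#j-≔j (j ∷ w) (suc x) e = cong suc (#j-≔j w x e)
#j-≔j (o ∷ w) (suc x) e = #j-≔j w x e

find-o : ∀ {n t} (w : Word n) → #o w ≡ suc t → ∃ λ x → lookup w x ≡ o
find-o (i ∷ w) e = let x , p = find-o w e in suc x , p
find-o (j ∷ w) e = let x , p = find-o w e in suc x , p
find-o (o ∷ w) e = zero , refl

find-j : ∀ {n q} (w : Word n) → #j w ≡ suc q →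
         ∃₂ λ v x → lookup v x ≡ o × w ≡ v [ x ]≔ j
find-j (i ∷ w) e = let v , x , p , r = find-j w e in i ∷ v , suc x , p , cong (i ∷_) r
find-j (j ∷ w) e = o ∷ w , zero , refl , refl
find-j (o ∷ w) e = let v , x , p , r = find-j w e in o ∷ v , suc x , p , cong (o ∷_) r

χ-low : ∀ {n} (S : Subset n) w q → #j w ℕ.< q → χ S w q ≡ 0ℚ
χ-low []            []      (suc q) _       = refl
χ-low (outside ∷ S) (i ∷ w) q       lt      = χ-low S w q lt
χ-low (inside ∷ S)  (i ∷ w) q       lt      = χ-low S w q lt
χ-low (outside ∷ S) (j ∷ w) (suc q) (s≤s l) = χ-low S w q l
χ-low (inside ∷ S)  (j ∷ w) q       lt      = χ-low S w q (ℕP.<-trans (ℕP.n<1+n _) lt)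
χ-low (outside ∷ S) (o ∷ w) q       lt      = χ-low S w q lt
χ-low (inside ∷ S)  (o ∷ w) q       lt      = refl

-- As |J| - |S| ≤ |J - S| ≤ |J|, this and `χ-low` confine the support of `χ S` to the layers q ≤ |J|
-- ≤ q + |S|.
χ-high : ∀ {n} (S : Subset n) w q → q ℕ.+ ∣ S ∣ ℕ.< #j w → χ S w q ≡ 0ℚ
χ-high []            []      q       ()
χ-high (outside ∷ S) (i ∷ w) q       lt      = χ-high S w q lt
χ-high (inside ∷ S)  (i ∷ w) q       lt      =
  χ-high S w q (ℕP.≤-<-trans (ℕP.+-monoʳ-≤ q (ℕP.n≤1+n _)) lt)
χ-high (outside ∷ S) (j ∷ w) zero    lt      = refl
χ-high (outside ∷ S) (j ∷ w) (suc q) (s≤s l) = χ-high S w q l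
χ-high (inside ∷ S)  (j ∷ w) q       lt      =
  χ-high S w q (ℕ.s≤s⁻¹ (subst (ℕ._< suc (#j w)) (ℕP.+-suc q ∣ S ∣) lt))
χ-high (outside ∷ S) (o ∷ w) q       lt      = χ-high S w q lt
χ-high (inside ∷ S)  (o ∷ w) q       lt      = refl

-- The balancing equation on words

record Balanced {n} (t : ℕ) (c : Word n → ℚ) : Set where
  constructor balanced
  field
    -- The word w carries one o more than the four words compared. The case x = y is included; there
    -- the equation is commutativity.
    balance : ∀ w x y → lookup w x ≡ o → lookup w y ≡ o → #o w ≡ suc t →
      c (w [ x ]≔ i) + c (w [ y ]≔ j) ≡ c (w [ x ]≔ j) + c (w [ y ]≔ i)
open Balanced

-- This is `χ-balance` with x the first position, outside S. If y ∈ S, the first and third terms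
-- vanish because y is an o, and the other two agree. If y ∉ S, an i at y changes nothing and a j at
-- y counts as much as a leading j, so the terms match crosswise.
χ-exchange : ∀ {n} (S : Subset n) w y q → lookup w y ≡ o →
  χ S w q + χ S (w [ y ]≔ j) q ≡ χ (outside ∷ S) (j ∷ w) q + χ S (w [ y ]≔ i) q
χ-exchange (outside ∷ S) (.o ∷ w) zero    zero    refl = ℚP.+-comm (χ S w 0) 0ℚ
χ-exchange (outside ∷ S) (.o ∷ w) zero    (suc q) refl = ℚP.+-comm (χ S w (suc q)) (χ S w q)
χ-exchange (inside ∷ S)  (.o ∷ w) zero    zero    refl = refl
χ-exchange (inside ∷ S)  (.o ∷ w) zero    (suc q) refl = refl
χ-exchange (outside ∷ S) (i ∷ w)  (suc y) zero    e    = χ-exchange S w y zero e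
χ-exchange (outside ∷ S) (i ∷ w)  (suc y) (suc q) e    = χ-exchange S w y (suc q) e
χ-exchange (inside ∷ S)  (i ∷ w)  (suc y) zero    e    = χ-exchange S w y zero e
χ-exchange (inside ∷ S)  (i ∷ w)  (suc y) (suc q) e    = χ-exchange S w y (suc q) e
χ-exchange (outside ∷ S) (j ∷ w)  (suc y) zero    e    = refl
χ-exchange (outside ∷ S) (j ∷ w)  (suc y) (suc zero) e    = χ-exchange S w y zero e
χ-exchange (outside ∷ S) (j ∷ w)  (suc y) (suc (suc q)) e    = χ-exchange S w y (suc q) e
χ-exchange (inside ∷ S)  (j ∷ w)  (suc y) zero    e    = χ-exchange S w y zero e
χ-exchange (inside ∷ S)  (j ∷ w)  (suc y) (suc q) e    = χ-exchange S w y (suc q) e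
χ-exchange (outside ∷ S) (o ∷ w)  (suc y) zero    e    = χ-exchange S w y zero e
χ-exchange (outside ∷ S) (o ∷ w)  (suc y) (suc q) e    = χ-exchange S w y (suc q) e
χ-exchange (inside ∷ S)  (o ∷ w)  (suc y) zero    e    = refl
χ-exchange (inside ∷ S)  (o ∷ w)  (suc y) (suc q) e    = refl

χ-balance : ∀ {n} (S : Subset n) w x y q → lookup w x ≡ o → lookup w y ≡ o →
  χ S (w [ x ]≔ i) q + χ S (w [ y ]≔ j) q ≡ χ S (w [ x ]≔ j) q + χ S (w [ y ]≔ i) q
χ-balance (s ∷ S) (.o ∷ w) zero zero q refl e′ = ℚP.+-comm (χ (s ∷ S) (i ∷ w) q) (χ (s ∷ S) (j ∷ w) q)
χ-balance (outside ∷ S) (.o ∷ w) zero (suc y) q refl e′ = χ-exchange S w y q e′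
χ-balance (inside ∷ S) (.o ∷ w) zero (suc y) q refl e′ = refl
χ-balance (outside ∷ S) (.o ∷ w) (suc x) zero q e refl =
  trans (ℚP.+-comm (χ S (w [ x ]≔ i) q) (χ (outside ∷ S) (j ∷ w) q))
    (trans (sym (χ-exchange S w x q e)) (ℚP.+-comm (χ S w q) (χ S (w [ x ]≔ j) q)))
χ-balance (inside ∷ S) (.o ∷ w) (suc x) zero q e refl = refl
χ-balance (outside ∷ S) (i ∷ w) (suc x) (suc y) q e e′ = χ-balance S w x y q e e′
χ-balance (inside ∷ S) (i ∷ w) (suc x) (suc y) q e e′ = χ-balance S w x y q e e′
χ-balance (outside ∷ S) (j ∷ w) (suc x) (suc y) zero e e′ = refl
χ-balance (outside ∷ S) (j ∷ w) (suc x) (suc y) (suc q) e e′ = χ-balance S w x y q e e′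
χ-balance (inside ∷ S) (j ∷ w) (suc x) (suc y) q e e′ = χ-balance S w x y q e e′
χ-balance (outside ∷ S) (o ∷ w) (suc x) (suc y) q e e′ = χ-balance S w x y q e e′
χ-balance (inside ∷ S) (o ∷ w) (suc x) (suc y) q e e′ = refl

-- Sums over small subsets and linear combinations of the χ

∑ : ∀ {n} → ℕ → (Subset n → ℚ) → ℚ
∑         zero    f = 0ℚ
∑ {zero}  (suc M) f = f []
∑ {suc n} (suc M) f = ∑ (suc M) (f ∘ (outside ∷_)) + ∑ M (f ∘ (inside ∷_))

∑-cong : ∀ {n} M {f g : Subset n → ℚ} → (∀ S → ∣ S ∣ ℕ.< M → f S ≡ g S) → ∑ M f ≡ ∑ M g
∑-cong         zero    e = refl
∑-cong {zero}  (suc M) e = e [] z<s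
∑-cong {suc n} (suc M) e =
  cong₂ _+_ (∑-cong (suc M) (e ∘ (outside ∷_))) (∑-cong M λ S lt → e (inside ∷ S) (s<s lt))

∑-0 : ∀ {n} M → ∑ {n} M (λ _ → 0ℚ) ≡ 0ℚ
∑-0         zero    = refl
∑-0 {zero}  (suc M) = refl
∑-0 {suc n} (suc M) = cong₂ _+_ (∑-0 {n} (suc M)) (∑-0 {n} M)

∑-+ : ∀ {n} M (f g : Subset n → ℚ) → ∑ M (λ S → f S + g S) ≡ ∑ M f + ∑ M g
∑-+         zero    f g = refl
∑-+ {zero}  (suc M) f g = refl
∑-+ {suc n} (suc M) f g =
  trans (cong₂ _+_ (∑-+ {n} (suc M) _ _) (∑-+ {n} M _ _))
    (solve 4 (λ a b c d → (a :+ b) :+ (c :+ d) := (a :+ c) :+ (b :+ d)) refl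
      (∑ (suc M) (f ∘ (outside ∷_))) (∑ (suc M) (g ∘ (outside ∷_)))
      (∑ M (f ∘ (inside ∷_))) (∑ M (g ∘ (inside ∷_))))

∑-* : ∀ {n} M k (f : Subset n → ℚ) → ∑ M (λ S → k * f S) ≡ k * ∑ M f
∑-*         zero    k f = sym (ℚP.*-zeroʳ k)
∑-* {zero}  (suc M) k f = refl
∑-* {suc n} (suc M) k f =
  trans (cong₂ _+_ (∑-* {n} (suc M) k _) (∑-* {n} M k _))
    (sym (ℚP.*-distribˡ-+ k (∑ (suc M) (f ∘ (outside ∷_))) (∑ M (f ∘ (inside ∷_)))))

-- `∑` splits on the first entry of S, so `comb q (suc M)` unfolds into a part over S ∌ 1 with bound
-- M + 1 and a part over S ∋ 1 with bound M. The bound |S| < M is strict so that M = 0 gives the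
-- empty sum, where the inductions stop.
comb : ∀ {n} → ℕ → ℕ → (Subset n → ℚ) → Word n → ℚ
comb q M a w = ∑ M (λ S → a S * χ S w q)

module _ {n : ℕ} (q M : ℕ) where

  comb-cong : ∀ {a b : Subset n → ℚ} → (∀ S → ∣ S ∣ ℕ.< M → a S ≡ b S) →
              ∀ w → comb q M a w ≡ comb q M b w
  comb-cong e w = ∑-cong M (λ S lt → cong (_* χ S w q) (e S lt))

  comb-0 : ∀ (w : Word n) → comb q M (λ _ → 0ℚ) w ≡ 0ℚ
  comb-0 w = trans (∑-cong M (λ S _ → ℚP.*-zeroˡ (χ S w q))) (∑-0 {n} M)

  comb-+ : ∀ (a b : Subset n → ℚ) w →
           comb q M (λ S → a S + b S) w ≡ comb q M a w + comb q M b w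
  comb-+ a b w =
    trans (∑-cong M (λ S _ → ℚP.*-distribʳ-+ (χ S w q) (a S) (b S))) (∑-+ M _ _)

  comb-* : ∀ k (a : Subset n → ℚ) w → comb q M (λ S → k * a S) w ≡ k * comb q M a w
  comb-* k a w = trans (∑-cong M (λ S _ → ℚP.*-assoc k (a S) (χ S w q))) (∑-* M k _)

  comb-low : ∀ (a : Subset n → ℚ) w → #j w ℕ.< q → comb q M a w ≡ 0ℚ
  comb-low a w lt = trans
    (∑-cong M (λ S _ → trans (cong (a S *_) (χ-low S w q lt)) (ℚP.*-zeroʳ (a S)))) (∑-0 {n} M)

  comb-high : ∀ (a : Subset n → ℚ) w → q ℕ.+ M ℕ.≤ #j w → comb q M a w ≡ 0ℚ
  comb-high a w le = trans
    (∑-cong M (λ S lt → trans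
      (cong (a S *_) (χ-high S w q (ℕP.<-≤-trans (ℕP.+-monoʳ-< q lt) le)))
      (ℚP.*-zeroʳ (a S))))
    (∑-0 {n} M)

  comb-balanced : ∀ t (a : Subset n → ℚ) → Balanced t (comb q M a)
  comb-balanced t a .balance w x y e e′ _ =
    trans (sym (∑-+ M _ _)) (trans (∑-cong M (λ S _ →
      trans (sym (ℚP.*-distribˡ-+ (a S) (χ S (w [ x ]≔ i) q) (χ S (w [ y ]≔ j) q)))
        (trans (cong (a S *_) (χ-balance S w x y q e e′))
          (ℚP.*-distribˡ-+ (a S) (χ S (w [ x ]≔ j) q) (χ S (w [ y ]≔ i) q)))))
      (∑-+ M _ _))

_▹_ : ∀ {n} → (Subset n → ℚ) → (Subset n → ℚ) → Subset (suc n) → ℚ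
(a ▹ b) (outside ∷ S) = a S
(a ▹ b) (inside ∷ S)  = b S

comb-o : ∀ {n} q M (a : Subset (suc n) → ℚ) (w : Word n) →
         comb q (suc M) a (o ∷ w) ≡ comb q (suc M) (a ∘ (outside ∷_)) w
comb-o {n} q M a w = trans (cong (comb q (suc M) (a ∘ (outside ∷_)) w +_)
  (trans (∑-cong M (λ S _ → ℚP.*-zeroʳ (a (inside ∷ S)))) (∑-0 {n} M))) (ℚP.+-identityʳ _)

comb-j₀ : ∀ {n} M (a : Subset (suc n) → ℚ) (w : Word n) →
          comb 0 (suc M) a (j ∷ w) ≡ comb 0 M (a ∘ (inside ∷_)) w
comb-j₀ {n} M a w = trans (cong (_+ comb 0 M (a ∘ (inside ∷_)) w)
    (trans (∑-cong (suc M) (λ S _ → ℚP.*-zeroʳ (a (outside ∷ S)))) (∑-0 {n} (suc M)))) (ℚP.+-identityˡ _)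

-- Recursive, so that `ι (suc n)` is by definition a polynomial in `ι n` for the ring solver.
ι : ℕ → ℚ
ι zero    = 0ℚ
ι (suc n) = 1ℚ + ι n

ι≥0 : ∀ n → 0ℚ ℚ.≤ ι n
ι≥0 zero    = ℚP.≤-refl
ι≥0 (suc n) = ℚP.+-mono-≤ {0ℚ} {1ℚ} {0ℚ} {ι n} (ℚP.nonNegative⁻¹ 1ℚ) (ι≥0 n)

ι>0 : ∀ n → 0ℚ ℚ.< ι (suc n)
ι>0 n = ℚP.+-mono-<-≤ {0ℚ} {1ℚ} {0ℚ} {ι n} (ℚP.positive⁻¹ 1ℚ) (ι≥0 n)

ι-inverse : ∀ n → ∃ λ ρ → ι (suc n) * ρ ≡ 1ℚ
ι-inverse n = 1/ ι (suc n) , ℚP.*-inverseʳ (ι (suc n))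
  where instance _ = ℚ.>-nonZero (ι>0 n)

-- Raising q

-- The up operator of the Boolean lattice: `up β T` is the sum of β(T - {x}) over x ∈ T. Summing it
-- against χ_q collects β(S) χ_q(S ∪ {x}) over all x ∉ S.
up : ∀ {n} → (Subset n → ℚ) → Subset n → ℚ
up β []            = 0ℚ
up β (outside ∷ T) = up (β ∘ (outside ∷_)) T
up β (inside ∷ T)  = up (β ∘ (inside ∷_)) T + β (outside ∷ T)

up-zero : ∀ {n} M (β : Subset n → ℚ) → (∀ S → ∣ S ∣ ℕ.< M → β S ≡ 0ℚ) →
          ∀ T → ∣ T ∣ ℕ.< suc M → up β T ≡ 0ℚ
up-zero M       β e []            lt       = refl
up-zero M       β e (outside ∷ T) lt       = up-zero M _ (e ∘ (outside ∷_)) T lt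
up-zero (suc M) β e (inside ∷ T)  (s≤s lt) =
  cong₂ _+_ (up-zero M _ (λ S l → e (inside ∷ S) (s<s l)) T lt) (e (outside ∷ T) lt)
up-zero zero    β e (inside ∷ T)  (s≤s ())

-- Lets a family meant for |S| < M take part in a sum over |S| < M + 1 without contributing at |S| =
-- M.
trunc : ∀ {n} → ℕ → (Subset n → ℚ) → Subset n → ℚ
trunc M β S with ∣ S ∣ ℕ.<? M
... | yes _ = β S
... | no  _ = 0ℚ

trunc-zero : ∀ {n} M (β : Subset n → ℚ) → (∀ S → ∣ S ∣ ℕ.< M → β S ≡ 0ℚ) → ∀ S → trunc M β S ≡ 0ℚ
trunc-zero M β e S with ∣ S ∣ ℕ.<? M
... | yes p = e S p
... | no  _ = refl

trunc-< : ∀ {n} M (β : Subset n → ℚ) S → ∣ S ∣ ℕ.< M → trunc M β S ≡ β S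
trunc-< M β S lt with ∣ S ∣ ℕ.<? M
... | yes _ = refl
... | no  p = contradiction lt p

∑-trunc : ∀ {n} M (β f : Subset n → ℚ) → (∀ S → M ℕ.≤ ∣ S ∣ → β S ≡ 0ℚ) →
  ∑ (suc M) (λ S → β S * f S) ≡ ∑ M (λ S → β S * f S)
∑-trunc {zero}  zero    β f z = trans (cong (_* f []) (z [] z≤n)) (ℚP.*-zeroˡ (f []))
∑-trunc {zero}  (suc M) β f z = refl
∑-trunc {suc n} zero    β f z =
  trans (ℚP.+-identityʳ _) (∑-trunc zero (β ∘ (outside ∷_)) (f ∘ (outside ∷_)) (λ S _ → z (outside ∷ S) z≤n))
∑-trunc {suc n} (suc M) β f z =
  cong₂ _+_ (∑-trunc (suc M) _ _ (z ∘ (outside ∷_)))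
            (∑-trunc M _ _ (λ S le → z (inside ∷ S) (s≤s le)))

comb-trunc : ∀ {n} q M (β : Subset n → ℚ) w → comb q (suc M) (trunc M β) w ≡ comb q M β w
comb-trunc q M β w = trans (∑-trunc M (trunc M β) _ tz) (comb-cong q M (trunc-< M β) w)
  where
  tz : ∀ S → M ℕ.≤ ∣ S ∣ → trunc M β S ≡ 0ℚ
  tz S le with ∣ S ∣ ℕ.<? M
  ... | yes p = contradiction (ℕP.<-≤-trans p le) (ℕP.<-irrefl refl)
  ... | no  _ = refl

deg : ∀ {n} → (Subset n → ℚ) → Subset n → ℚ
deg β S = ι ∣ S ∣ * β S

comb-deg-in : ∀ {n} q M (β : Subset (suc n) → ℚ) w →
  comb q M (deg β ∘ (inside ∷_)) w ≡ comb q M (β ∘ (inside ∷_)) w + comb q M (deg (β ∘ (inside ∷_))) w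
comb-deg-in q M β w = trans
  (comb-cong q M (λ S _ → solve 2 (λ k b → (con 1ℚ :+ k) :* b := b :+ k :* b) refl (ι ∣ S ∣) (β (inside ∷ S))) w)
  (comb-+ q M (β ∘ (inside ∷_)) (deg (β ∘ (inside ∷_))) w)

-- In the sum of χ_q(S ∪ {x}) over x ∉ S, an x ∈ O contributes 0, each x ∈ I - S contributes χ_q(S),
-- and each x ∈ J - S contributes χ_{q+1}(S), whose support has q + 1 such x. The |S| inside |I - S|
-- is moved to the right as `deg`, so the coefficient left over depends on w only.
comb-up : ∀ {n} q M (β : Subset n → ℚ) w →
  ι (suc q) * comb (suc q) M β w + (ι n - ι (#o w) - ι q) * comb q M β w ≡
  comb q (suc M) (up β) w + comb q M (deg β) w
comb-up {n} q zero β w = begin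
  ι (suc q) * 0ℚ + (ι n - ι (#o w) - ι q) * 0ℚ
    ≡⟨ cong₂ _+_ (ℚP.*-zeroʳ (ι (suc q))) (ℚP.*-zeroʳ (ι n - ι (#o w) - ι q)) ⟩
  0ℚ + 0ℚ
    ≡⟨ cong (_+ 0ℚ) (comb-0 q 1 w) ⟨
  comb q 1 (λ _ → 0ℚ) w + 0ℚ
    ≡⟨ cong (_+ 0ℚ) (comb-cong q 1 (λ S lt → sym (up-zero 0 β (λ _ ()) S lt)) w) ⟩
  comb q 1 (up β) w + 0ℚ ∎
comb-up zero (suc M) β [] =
  solve 1 (λ b → con (ι 1) :* (b :* con 0ℚ) :+ con (0ℚ - 0ℚ - 0ℚ) :* (b :* con 1ℚ) :=
    con 0ℚ :* con 1ℚ :+ con 0ℚ :* b :* con 1ℚ) refl (β [])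
comb-up (suc q) (suc M) β [] =
  solve 2 (λ b k → (con 1ℚ :+ (con 1ℚ :+ k)) :* (b :* con 0ℚ) :+ (con 0ℚ :- con 0ℚ :- (con 1ℚ :+ k)) :* (b :* con 0ℚ) :=
    con 0ℚ :* con 0ℚ :+ con 0ℚ :* b :* con 0ℚ) refl (β []) (ι q)
comb-up {suc n} q (suc M) β (o ∷ w) = begin
  ι (suc q) * comb (suc q) (suc M) β (o ∷ w) + ((1ℚ + ι n) - (1ℚ + ι (#o w)) - ι q) * comb q (suc M) β (o ∷ w)
    ≡⟨ cong₂ _+_ (cong (ι (suc q) *_) (comb-o (suc q) M β w))
         (cong₂ _*_ (solve 3 (λ a b c → (con 1ℚ :+ a) :- (con 1ℚ :+ b) :- c := a :- b :- c) refl
                       (ι n) (ι (#o w)) (ι q))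
                    (comb-o q M β w)) ⟩
  ι (suc q) * comb (suc q) (suc M) (β ∘ (outside ∷_)) w + (ι n - ι (#o w) - ι q) * comb q (suc M) (β ∘ (outside ∷_)) w
    ≡⟨ comb-up q (suc M) (β ∘ (outside ∷_)) w ⟩
  comb q (suc (suc M)) (up (β ∘ (outside ∷_))) w + comb q (suc M) (deg (β ∘ (outside ∷_))) w
    ≡⟨ cong₂ _+_ (comb-o q (suc M) (up β) w) (comb-o q M (deg β) w) ⟨
  comb q (suc (suc M)) (up β) (o ∷ w) + comb q (suc M) (deg β) (o ∷ w) ∎
-- Beyond the two identities for the tail there is a surplus Y + D, due to the first element: Y for
-- adding it to an S that lacks it, D for its share of |S| when S contains it.
comb-up {suc n} q (suc M) β (i ∷ w) = begin
  ι (suc q) * (A + B) + ((1ℚ + ι n) - ι (#o w) - ι q) * (Y + D)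
    ≡⟨ solve 8 (λ k a b n m q c d → k :* (a :+ b) :+ ((con 1ℚ :+ n) :- m :- q) :* (c :+ d) :=
         (k :* a :+ (n :- m :- q) :* c) :+ (k :* b :+ (n :- m :- q) :* d) :+ c :+ d) refl
         (ι (suc q)) A B (ι n) (ι (#o w)) (ι q) Y D ⟩
  (ι (suc q) * A + (ι n - ι (#o w) - ι q) * Y) + (ι (suc q) * B + (ι n - ι (#o w) - ι q) * D) + Y + D
    ≡⟨ cong₂ (λ u v → u + v + Y + D) (comb-up q (suc M) β₀ w) (comb-up q M β₁ w) ⟩
  (E + F) + (G + H) + Y + D
    ≡⟨ solve 6 (λ e f g h c d → (e :+ f) :+ (g :+ h) :+ c :+ d := (e :+ (g :+ c)) :+ (f :+ (d :+ h))) refl E F G H Y D ⟩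
  (E + (G + Y)) + (F + (D + H))
    ≡⟨ cong₂ (λ u v → (E + u) + (F + v)) (comb-+ q (suc M) (up β₁) β₀ w) (comb-deg-in q M β w) ⟨
  comb q (suc (suc M)) (up β) (i ∷ w) + comb q (suc M) (deg β) (i ∷ w) ∎
  where
  β₀ β₁ : Subset n → ℚ
  β₀ = β ∘ (outside ∷_)
  β₁ = β ∘ (inside ∷_)
  A B Y D E F G H : ℚ
  A = comb (suc q) (suc M) β₀ w
  B = comb (suc q) M β₁ w
  Y = comb q (suc M) β₀ w
  D = comb q M β₁ w
  E = comb q (suc (suc M)) (up β₀) w
  F = comb q (suc M) (deg β₀) w
  G = comb q (suc M) (up β₁) w
  H = comb q M (deg β₁) w
-- A leading j outside S lowers the index of χ by one on the tail. The surplus is now A + D: the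
-- term for adding the first element to S is A, taken from the coefficient q + 2 where the tail
-- needs only q + 1.
comb-up {suc n} (suc q) (suc M) β (j ∷ w) = begin
  (1ℚ + ι (suc q)) * (A + B) + ((1ℚ + ι n) - ι (#o w) - (1ℚ + ι q)) * (Y + D)
    ≡⟨ solve 7 (λ a b n m q c d →
         (con 1ℚ :+ (con 1ℚ :+ q)) :* (a :+ b) :+ ((con 1ℚ :+ n) :- m :- (con 1ℚ :+ q)) :* (c :+ d) :=
         ((con 1ℚ :+ q) :* a :+ (n :- m :- q) :* c) :+
         ((con 1ℚ :+ (con 1ℚ :+ q)) :* b :+ (n :- m :- (con 1ℚ :+ q)) :* d) :+ a :+ d) refl
         A B (ι n) (ι (#o w)) (ι q) Y D ⟩
  (ι (suc q) * A + (ι n - ι (#o w) - ι q) * Y) +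
    (ι (suc (suc q)) * B + (ι n - ι (#o w) - ι (suc q)) * D) + A + D
    ≡⟨ cong₂ (λ u v → u + v + A + D) (comb-up q (suc M) β₀ w) (comb-up (suc q) M β₁ w) ⟩
  (E + F) + (G + H) + A + D
    ≡⟨ solve 6 (λ e f g h a d → (e :+ f) :+ (g :+ h) :+ a :+ d := (e :+ (g :+ a)) :+ (f :+ (d :+ h))) refl E F G H A D ⟩
  (E + (G + A)) + (F + (D + H))
    ≡⟨ cong₂ (λ u v → (E + u) + (F + v)) (comb-+ (suc q) (suc M) (up β₁) β₀ w) (comb-deg-in (suc q) M β w) ⟨
  comb (suc q) (suc (suc M)) (up β) (j ∷ w) + comb (suc q) (suc M) (deg β) (j ∷ w) ∎
  where
  β₀ β₁ : Subset n → ℚ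
  β₀ = β ∘ (outside ∷_)
  β₁ = β ∘ (inside ∷_)
  A B Y D E F G H : ℚ
  A = comb (suc q) (suc M) β₀ w
  B = comb (suc (suc q)) M β₁ w
  Y = comb q (suc M) β₀ w
  D = comb (suc q) M β₁ w
  E = comb q (suc (suc M)) (up β₀) w
  F = comb q (suc M) (deg β₀) w
  G = comb (suc q) (suc M) (up β₁) w
  H = comb (suc q) M (deg β₁) w
comb-up {suc n} zero (suc M) β (j ∷ w) = begin
  ι 1 * (A + B) + ((1ℚ + ι n) - ι (#o w) - 0ℚ) * comb 0 (suc M) β (j ∷ w)
    ≡⟨ cong (λ u → ι 1 * (A + B) + ((1ℚ + ι n) - ι (#o w) - 0ℚ) * u) (comb-j₀ M β w) ⟩
  ι 1 * (A + B) + ((1ℚ + ι n) - ι (#o w) - 0ℚ) * D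
    ≡⟨ solve 5 (λ a b n m d →
         con (ι 1) :* (a :+ b) :+ ((con 1ℚ :+ n) :- m :- con 0ℚ) :* d :=
         (con (ι 1) :* b :+ (n :- m :- con 0ℚ) :* d) :+ a :+ d) refl
         A B (ι n) (ι (#o w)) D ⟩
  (ι 1 * B + (ι n - ι (#o w) - 0ℚ) * D) + A + D
    ≡⟨ cong (λ u → u + A + D) (comb-up 0 M β₁ w) ⟩
  (G + H) + A + D
    ≡⟨ solve 4 (λ g h a d → (g :+ h) :+ a :+ d := (g :+ a) :+ (d :+ h)) refl G H A D ⟩
  (G + A) + (D + H)
    ≡⟨ cong₂ _+_ (trans (comb-j₀ (suc M) (up β) w) (comb-+ 0 (suc M) (up β₁) β₀ w))
                 (trans (comb-j₀ M (deg β) w) (comb-deg-in 0 M β w)) ⟨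
  comb 0 (suc (suc M)) (up β) (j ∷ w) + comb 0 (suc M) (deg β) (j ∷ w) ∎
  where
  β₀ β₁ : Subset n → ℚ
  β₀ = β ∘ (outside ∷_)
  β₁ = β ∘ (inside ∷_)
  A B D G H : ℚ
  A = comb 0 (suc M) β₀ w
  B = comb 1 M β₁ w
  D = comb 0 M β₁ w
  G = comb 0 (suc M) (up β₁) w
  H = comb 0 M (deg β₁) w

-- On words with n - #o w - q = κ, this solves
-- (q + 1) ∑ β(S) χ_{q+1}(S) = ∑ (raise β)(S) χ_q(S).
raise : ∀ {n} → ℕ → ℚ → (Subset n → ℚ) → Subset n → ℚ
raise M κ β T = up β T + trunc M (λ S → ι ∣ S ∣ * β S - κ * β S) T

comb-raise : ∀ {n} q M κ (β : Subset n → ℚ) w → ι n - ι (#o w) - ι q ≡ κ →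
  comb q (suc M) (raise M κ β) w ≡ ι (suc q) * comb (suc q) M β w
comb-raise {n} q M κ β w refl = begin
  comb q (suc M) (raise M κ β) w
    ≡⟨ comb-+ q (suc M) (up β) _ w ⟩
  U + comb q (suc M) (trunc M (λ S → deg β S - κ * β S)) w
    ≡⟨ cong (U +_) (comb-trunc q M _ w) ⟩
  U + comb q M (λ S → deg β S - κ * β S) w
    ≡⟨ cong (U +_) (comb-cong q M (λ S _ → cong (deg β S +_) (ℚP.neg-distribˡ-* κ (β S))) w) ⟩
  U + comb q M (λ S → deg β S + (- κ) * β S) w
    ≡⟨ cong (U +_) (trans (comb-+ q M (deg β) _ w) (cong (D +_) (comb-* q M (- κ) β w))) ⟩
  U + (D + (- κ) * Y)
    ≡⟨ ℚP.+-assoc U D ((- κ) * Y) ⟨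
  (U + D) + (- κ) * Y
    ≡⟨ cong (_+ (- κ) * Y) (comb-up q M β w) ⟨
  (ι (suc q) * comb (suc q) M β w + κ * Y) + (- κ) * Y
    ≡⟨ solve 3 (λ a k c → (a :+ k :* c) :+ (:- k) :* c := a) refl (ι (suc q) * comb (suc q) M β w) κ Y ⟩
  ι (suc q) * comb (suc q) M β w ∎
  where
  U D Y : ℚ
  U = comb q (suc M) (up β) w
  D = comb q M (deg β) w
  Y = comb q M β w

raise-zero : ∀ {n} M κ (β : Subset n → ℚ) → (∀ S → ∣ S ∣ ℕ.< M → β S ≡ 0ℚ) →
             ∀ T → ∣ T ∣ ℕ.< suc M → raise M κ β T ≡ 0ℚ
raise-zero M κ β e T lt = cong₂ _+_ (up-zero M β e T lt) (trunc-zero M _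
  (λ S l → trans (cong (λ b → ι ∣ S ∣ * b - κ * b) (e S l))
    (solve 2 (λ a k → a :* con 0ℚ :- k :* con 0ℚ := con 0ℚ) refl (ι ∣ S ∣) κ)) T)

-- Independence and spanning on words

ι-cancel : ∀ q {u : ℚ} → ι (suc q) * u ≡ 0ℚ → u ≡ 0ℚ
ι-cancel q {u} e = begin
  u                        ≡⟨ ℚP.*-identityˡ u ⟨
  1ℚ * u                   ≡⟨ cong (_* u) (proj₂ (ι-inverse q)) ⟨
  (ι (suc q) * ρ) * u      ≡⟨ solve 3 (λ k r u → (k :* r) :* u := r :* (k :* u)) refl (ι (suc q)) ρ u ⟩
  ρ * (ι (suc q) * u)      ≡⟨ cong (ρ *_) e ⟩
  ρ * 0ℚ                   ≡⟨ ℚP.*-zeroʳ ρ ⟩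
  0ℚ                       ∎
  where
  ρ : ℚ
  ρ = proj₁ (ι-inverse q)

ι-divide : ∀ q (u : ℚ) → ι (suc q) * (proj₁ (ι-inverse q) * u) ≡ u
ι-divide q u = begin
  ι (suc q) * (ρ * u)   ≡⟨ ℚP.*-assoc (ι (suc q)) ρ u ⟨
  (ι (suc q) * ρ) * u   ≡⟨ cong (_* u) (proj₂ (ι-inverse q)) ⟩
  1ℚ * u                ≡⟨ ℚP.*-identityˡ u ⟩
  u                     ∎
  where
  ρ : ℚ
  ρ = proj₁ (ι-inverse q)

-- Trading one o for one more unit of q does not change κ, so a single `raise` serves the tails of
-- words j w at q and the tails of words o w at q + 1.
κ-shift : ∀ n t q → ι n - ι t - (1ℚ + ι q) ≡ ι n - (1ℚ + ι t) - ι q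
κ-shift n t q = solve 3 (λ n t q → n :- t :- (con 1ℚ :+ q) := n :- (con 1ℚ :+ t) :- q) refl (ι n) (ι t) (ι q)

summand-0 : ∀ (u v : ℚ) → u + v ≡ 0ℚ → u ≡ 0ℚ → v ≡ 0ℚ
summand-0 u v e refl = trans (sym (ℚP.+-identityˡ v)) e

-- The bound q + t + M ≤ n + 1 says that t letters o and q + |S| letters j fit into a word whenever
-- |S| < M. For q = t = 0 the functions χ_0(S) = [J ⊆ S] live on all words over {i, j}, where the
-- induction keeps M while n drops. For q > 0 the condition M ≤ t keeps t positive as long as M is;
-- the steps with q = 0 lower t alone and would not preserve it.
independent : ∀ n t q M (a : Subset n → ℚ) → q ≡ 0 ⊎ M ℕ.≤ t → t ≡ 0 × q ≡ 0 ⊎ q ℕ.+ t ℕ.+ M ℕ.≤ suc n →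
  (∀ w → #o w ≡ t → comb q M a w ≡ 0ℚ) → ∀ S → ∣ S ∣ ℕ.< M → a S ≡ 0ℚ
independent n t q zero a _ _ _ S ()
independent zero zero zero (suc M) a _ _ f [] _ = trans (sym (ℚP.*-identityʳ (a []))) (f [] refl)
independent (suc n) zero zero (suc M) a c d f = λ where
    (inside ∷ S) (s≤s lt) → aᵢ S lt
    (outside ∷ S) lt → independent n 0 0 (suc M) (a ∘ (outside ∷_)) (inj₁ refl) (inj₁ (refl , refl))
      (λ w e → summand-0 _ _
        (trans (ℚP.+-comm _ (comb 0 (suc M) (a ∘ (outside ∷_)) w)) (f (i ∷ w) e))
        (trans (comb-cong 0 M aᵢ w) (comb-0 0 M w))) S lt
  where
  aᵢ : ∀ S → ∣ S ∣ ℕ.< M → a (inside ∷ S) ≡ 0ℚ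
  aᵢ = independent n 0 0 M (a ∘ (inside ∷_)) (inj₁ refl) (inj₁ (refl , refl))
    (λ w e → trans (sym (comb-j₀ M a w)) (f (j ∷ w) e))
independent zero (suc t) zero (suc M) a _ (inj₂ (s≤s p)) f = contradiction (subst (ℕ._≤ 0) (ℕP.+-suc t M) p) λ ()
independent (suc n) (suc t) zero (suc M) a _ (inj₂ (s≤s p)) f = λ where
    (inside ∷ S) (s≤s lt) → independent n (suc t) 0 M (a ∘ (inside ∷_)) (inj₁ refl)
      (inj₂ (subst (ℕ._≤ suc n) (ℕP.+-suc t M) p)) (λ w e → trans (sym (comb-j₀ M a w)) (f (j ∷ w) e)) S lt
    (outside ∷ S) lt → independent n t 0 (suc M) (a ∘ (outside ∷_)) (inj₁ refl) (inj₂ p)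
      (λ w e → trans (sym (comb-o 0 M a w)) (f (o ∷ w) (cong suc e))) S lt
independent _ zero (suc q) (suc M) a (inj₂ ()) _ f
independent zero (suc t) (suc q) (suc M) a _ (inj₂ (s≤s p)) f =
  contradiction (ℕP.≤-trans (ℕP.m≤n+m (suc M) (q ℕ.+ suc t)) p) λ ()
independent (suc n) (suc t) (suc q) (suc M) a (inj₂ (s≤s le)) (inj₂ (s≤s p)) f = λ where
    (inside ∷ S) (s≤s lt) → trans (sym (ι-divide q (aᵢ S))) (trans (cong (ι (suc q) *_) (β≡0 S lt)) (ℚP.*-zeroʳ (ι (suc q))))
    (outside ∷ S) lt → summand-0 (U S) (aₒ S)
      (trans (ℚP.+-comm (U S) (aₒ S)) (a+U≡0 S lt)) (raise-zero M κ β β≡0 S lt)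
  where
  aₒ aᵢ β U : Subset n → ℚ
  κ : ℚ
  aₒ = a ∘ (outside ∷_)
  aᵢ = a ∘ (inside ∷_)
  -- Dividing by q + 1 lets `comb-raise` turn the S ∋ 1 part of a word j w, a combination of
  -- χ_{q+1}, into the combination U of χ_q. The words j w then give one relation among the χ_q,
  -- with coefficients aₒ + U.
  β S = proj₁ (ι-inverse q) * aᵢ S
  κ = ι n - ι (suc t) - ι q
  U = raise M κ β
  a+U≡0 : ∀ S → ∣ S ∣ ℕ.< suc M → aₒ S + U S ≡ 0ℚ
  a+U≡0 = independent n (suc t) q (suc M) (λ S → aₒ S + U S) (inj₂ (s≤s le)) (inj₂ p) λ w e → begin
    comb q (suc M) (λ S → aₒ S + U S) w
      ≡⟨ comb-+ q (suc M) aₒ U w ⟩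
    comb q (suc M) aₒ w + comb q (suc M) U w
      ≡⟨ cong (comb q (suc M) aₒ w +_) (comb-raise q M κ β w (cong (λ t → ι n - ι t - ι q) e)) ⟩
    comb q (suc M) aₒ w + ι (suc q) * comb (suc q) M β w
      ≡⟨ cong (comb q (suc M) aₒ w +_) (comb-* (suc q) M (ι (suc q)) β w) ⟨
    comb q (suc M) aₒ w + comb (suc q) M (λ S → ι (suc q) * β S) w
      ≡⟨ cong (comb q (suc M) aₒ w +_) (comb-cong (suc q) M (λ S _ → ι-divide q (aᵢ S)) w) ⟩
    comb (suc q) (suc M) a (j ∷ w)
      ≡⟨ f (j ∷ w) e ⟩
    0ℚ ∎
  -- On words o w only aₒ = -U counts. Reading `comb-raise` backwards at q + 1, the relation with
  -- coefficients U becomes q + 2 times a relation among the χ_{q+2} with coefficients β.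
  β≡0 : ∀ S → ∣ S ∣ ℕ.< M → β S ≡ 0ℚ
  β≡0 = independent n t (suc (suc q)) M β (inj₂ le)
    (inj₂ (subst (ℕ._≤ suc n) (trans (cong (ℕ._+ suc M) (ℕP.+-suc q t)) (cong suc (ℕP.+-suc (q ℕ.+ t) M))) p))
    λ w e → ι-cancel (suc q) (trans
      (sym (comb-raise (suc q) M κ β w (trans (κ-shift n (#o w) q) (cong (λ t → ι n - (1ℚ + ι t) - ι q) e))))
      (summand-0 (comb (suc q) (suc M) aₒ w) (comb (suc q) (suc M) U w)
        (trans (sym (comb-+ (suc q) (suc M) aₒ U w))
          (trans (comb-cong (suc q) (suc M) a+U≡0 w) (comb-0 (suc q) (suc M) w)))
        (trans (sym (comb-o (suc q) M a w)) (f (o ∷ w) (cong suc e)))))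

-- M is the number of layers |J| = q, ..., q + M - 1 on which values may be nonzero.
record Weighted {n} (t q M : ℕ) (c : Word n → ℚ) : Set where
  constructor weighted
  field
    bal  : Balanced t c
    low  : ∀ w → #o w ≡ t → #j w ℕ.< q → c w ≡ 0ℚ
    high : ∀ w → #o w ≡ t → q ℕ.+ M ℕ.≤ #j w → c w ≡ 0ℚ
open Weighted

comb-weighted : ∀ {n} t q M (a : Subset n → ℚ) → Weighted t q M (comb q M a)
comb-weighted t q M a = weighted (comb-balanced q M t a)
  (λ w _ → comb-low q M a w) (λ w _ → comb-high q M a w)

-- `#o (l ∷ [])` is 1 for l = o and 0 otherwise: fixing a leading o leaves the tail one o fewer.
Balanced-tail : ∀ {n t} {c : Word (suc n) → ℚ} l → Balanced (#o (l ∷ []) ℕ.+ t) c → Balanced t (c ∘ (l ∷_))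
Balanced-tail i b .balance w x y e e′ s = b .balance (i ∷ w) (suc x) (suc y) e e′ s
Balanced-tail j b .balance w x y e e′ s = b .balance (j ∷ w) (suc x) (suc y) e e′ s
Balanced-tail o b .balance w x y e e′ s = b .balance (o ∷ w) (suc x) (suc y) e e′ (cong suc s)

Balanced-minus : ∀ {n t} {c e : Word n → ℚ} → Balanced t c → Balanced t e → Balanced t (λ w → c w - e w)
Balanced-minus {c = c} {e} b b′ .balance w x y p p′ s = begin
  (c₁ - e₁) + (c₂ - e₂)
    ≡⟨ solve 4 (λ a b c d → (a :- b) :+ (c :- d) := (a :+ c) :- (b :+ d)) refl c₁ e₁ c₂ e₂ ⟩
  (c₁ + c₂) - (e₁ + e₂)
    ≡⟨ cong₂ _-_ (b .balance w x y p p′ s) (b′ .balance w x y p p′ s) ⟩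
  (c₃ + c₄) - (e₃ + e₄)
    ≡⟨ solve 4 (λ a b c d → (a :+ c) :- (b :+ d) := (a :- b) :+ (c :- d)) refl c₃ e₃ c₄ e₄ ⟩
  (c₃ - e₃) + (c₄ - e₄) ∎
  where
  c₁ c₂ c₃ c₄ e₁ e₂ e₃ e₄ : ℚ
  c₁ = c (w [ x ]≔ i)
  c₂ = c (w [ y ]≔ j)
  c₃ = c (w [ x ]≔ j)
  c₄ = c (w [ y ]≔ i)
  e₁ = e (w [ x ]≔ i)
  e₂ = e (w [ y ]≔ j)
  e₃ = e (w [ x ]≔ j)
  e₄ = e (w [ y ]≔ i)

minus-0 : ∀ {u v : ℚ} → u ≡ 0ℚ → v ≡ 0ℚ → u - v ≡ 0ℚ
minus-0 refl refl = refl

-- The balancing equation for `o ∷ w` at the first position and at some o of w involves i w and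
-- three words starting with j or o. Having `suc t` letters o guarantees that w offers such a
-- position.
Balanced-i : ∀ {n t} {c e : Word (suc n) → ℚ} → Balanced (suc t) c → Balanced (suc t) e →
  (∀ w → #o w ≡ suc t → c (j ∷ w) ≡ e (j ∷ w)) → (∀ w → #o w ≡ t → c (o ∷ w) ≡ e (o ∷ w)) →
  ∀ w → #o w ≡ suc t → c (i ∷ w) ≡ e (i ∷ w)
Balanced-i {c = c} {e} b b′ onj ono w s =
  let y , p = find-o w s
      si = ℕP.suc-injective (trans (#o-≔i w y p) s)
      sj = ℕP.suc-injective (trans (#o-≔j w y p) s)
  in ℚG.∙-cancelʳ _ (c (i ∷ w)) (e (i ∷ w)) (begin
    c (i ∷ w) + c (o ∷ w [ y ]≔ j) ≡⟨ b .balance (o ∷ w) zero (suc y) refl p (cong suc s) ⟩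
    c (j ∷ w) + c (o ∷ w [ y ]≔ i) ≡⟨ cong₂ _+_ (onj w s) (ono _ si) ⟩
    e (j ∷ w) + e (o ∷ w [ y ]≔ i) ≡⟨ b′ .balance (o ∷ w) zero (suc y) refl p (cong suc s) ⟨
    e (i ∷ w) + e (o ∷ w [ y ]≔ j) ≡⟨ cong (e (i ∷ w) +_) (ono _ sj) ⟨
    e (i ∷ w) + c (o ∷ w [ y ]≔ j) ∎)

-- On the lowest layer, two of the four balanced words have one j too few and carry the value 0. So
-- the words j v already determine the words with leading o there.
Weighted-lowest : ∀ {n t q M} {c : Word (suc n) → ℚ} → Weighted (suc t) (suc q) M c →
  ∀ v x → lookup v x ≡ o → #o v ≡ suc t → #j v ≡ q → c (o ∷ v [ x ]≔ j) ≡ c (j ∷ v)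
Weighted-lowest {c = c} W v x p s refl = begin
  c (o ∷ v [ x ]≔ j)             ≡⟨ ℚP.+-identityˡ _ ⟨
  0ℚ + c (o ∷ v [ x ]≔ j)        ≡⟨ cong (_+ c (o ∷ v [ x ]≔ j)) (W .low (i ∷ v) s (ℕP.n<1+n _)) ⟨
  c (i ∷ v) + c (o ∷ v [ x ]≔ j) ≡⟨ W .bal .balance (o ∷ v) zero (suc x) refl p (cong suc s) ⟩
  c (j ∷ v) + c (o ∷ v [ x ]≔ i) ≡⟨ cong (c (j ∷ v) +_) (W .low (o ∷ v [ x ]≔ i)
                                      (trans (#o-≔i v x p) s) (s≤s (ℕP.≤-reflexive (#j-≔i v x p)))) ⟩
  c (j ∷ v) + 0ℚ                 ≡⟨ ℚP.+-identityʳ _ ⟩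
  c (j ∷ v)                      ∎

spans : ∀ n t q M (c : Word n → ℚ) → q ≡ 0 ⊎ M ℕ.≤ t → Weighted t q M c →
        ∃ λ a → ∀ w → #o w ≡ t → c w ≡ comb q M a w
spans n t q zero c _ W = (λ _ → 0ℚ) , λ w s → vanish w s (ℕP.≤-<-connex q (#j w))
  where
  vanish : ∀ w → #o w ≡ t → q ℕ.≤ #j w ⊎ #j w ℕ.< q → c w ≡ 0ℚ
  vanish w s (inj₁ le) = W .high w s (subst (ℕ._≤ #j w) (sym (ℕP.+-identityʳ q)) le)
  vanish w s (inj₂ lt) = W .low w s lt
spans zero zero zero (suc M) c _ W = (λ _ → c []) , λ where [] _ → sym (ℚP.*-identityʳ (c []))
spans zero (suc t) q (suc M) c _ W = (λ _ → 0ℚ) , λ where [] ()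
spans zero zero (suc q) (suc M) c (inj₂ ())
spans (suc n) zero (suc q) (suc M) c (inj₂ ())
spans (suc n) zero zero (suc M) c _ W = (aₒ ▹ aᵢ) , agree
  where
  onj : ∃ λ a → ∀ w → #o w ≡ 0 → c (j ∷ w) ≡ comb 0 M a w
  onj = spans n 0 0 M (c ∘ (j ∷_)) (inj₁ refl) (weighted (Balanced-tail j (W .bal)) (λ _ _ ())
    (λ w s le → W .high (j ∷ w) s (s≤s le)))
  aᵢ aₒ : Subset n → ℚ
  aᵢ = proj₁ onj
  -- Without an o there is nothing to trade, so the words i w are handled directly. Both kinds of S
  -- contribute to them, and the known part from S ∋ 1 is subtracted first.
  oni : ∃ λ a → ∀ w → #o w ≡ 0 → c (i ∷ w) - comb 0 M aᵢ w ≡ comb 0 (suc M) a w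
  oni = spans n 0 0 (suc M) _ (inj₁ refl) (weighted
    (Balanced-minus (Balanced-tail i (W .bal)) (comb-balanced 0 M 0 aᵢ)) (λ _ _ ())
    (λ w s le → minus-0 (W .high (i ∷ w) s le) (comb-high 0 M aᵢ w (ℕP.≤-trans (ℕP.n≤1+n M) le))))
  aₒ = proj₁ oni
  agree : ∀ w → #o w ≡ 0 → c w ≡ comb 0 (suc M) (aₒ ▹ aᵢ) w
  agree (i ∷ w) s = trans
    (solve 2 (λ c e → c := (c :- e) :+ e) refl (c (i ∷ w)) (comb 0 M aᵢ w))
    (cong (_+ comb 0 M aᵢ w) (proj₂ oni w s))
  agree (j ∷ w) s = trans (proj₂ onj w s) (sym (comb-j₀ M (aₒ ▹ aᵢ) w))
spans (suc n) (suc t) zero (suc M) c _ W = (aₒ ▹ aᵢ) , agree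
  where
  onj : ∃ λ a → ∀ w → #o w ≡ suc t → c (j ∷ w) ≡ comb 0 M a w
  onj = spans n (suc t) 0 M (c ∘ (j ∷_)) (inj₁ refl) (weighted (Balanced-tail j (W .bal)) (λ _ _ ())
    (λ w s le → W .high (j ∷ w) s (s≤s le)))
  ono : ∃ λ a → ∀ w → #o w ≡ t → c (o ∷ w) ≡ comb 0 (suc M) a w
  ono = spans n t 0 (suc M) (c ∘ (o ∷_)) (inj₁ refl) (weighted (Balanced-tail o (W .bal)) (λ _ _ ())
    (λ w s le → W .high (o ∷ w) (cong suc s) le))
  aᵢ aₒ : Subset n → ℚ
  aᵢ = proj₁ onj
  aₒ = proj₁ ono
  agree-j : ∀ w → #o w ≡ suc t → c (j ∷ w) ≡ comb 0 (suc M) (aₒ ▹ aᵢ) (j ∷ w)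
  agree-j w s = trans (proj₂ onj w s) (sym (comb-j₀ M (aₒ ▹ aᵢ) w))
  agree-o : ∀ w → #o w ≡ t → c (o ∷ w) ≡ comb 0 (suc M) (aₒ ▹ aᵢ) (o ∷ w)
  agree-o w s = trans (proj₂ ono w s) (sym (comb-o 0 M (aₒ ▹ aᵢ) w))
  agree : ∀ w → #o w ≡ suc t → c w ≡ comb 0 (suc M) (aₒ ▹ aᵢ) w
  agree (i ∷ w) s = Balanced-i (W .bal) (comb-balanced 0 (suc M) (suc t) (aₒ ▹ aᵢ)) agree-j agree-o w s
  agree (j ∷ w) s = agree-j w s
  agree (o ∷ w) s = agree-o w (ℕP.suc-injective s)
spans (suc n) (suc t) (suc q) (suc M) c (inj₂ (s≤s le)) W = (aₒ ▹ aᵢ) , agree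
  where
  onj : ∃ λ a → ∀ w → #o w ≡ suc t → c (j ∷ w) ≡ comb q (suc M) a w
  onj = spans n (suc t) q (suc M) (c ∘ (j ∷_)) (inj₂ (s≤s le)) (weighted (Balanced-tail j (W .bal))
    (λ w s lt → W .low (j ∷ w) s (s<s lt)) (λ w s le → W .high (j ∷ w) s (s≤s le)))
  a β aₒ aᵢ : Subset n → ℚ
  a = proj₁ onj
  -- A provisional solution, supported on S ∌ 1 and right on the words j w; d is its error on the
  -- words o w.
  a⁺ : Subset (suc n) → ℚ
  a⁺ = (a ▹ (λ _ → 0ℚ))
  a⁺-j : ∀ w → comb (suc q) (suc M) a⁺ (j ∷ w) ≡ comb q (suc M) a w
  a⁺-j w = trans (cong (comb q (suc M) a w +_) (comb-0 (suc q) M w)) (ℚP.+-identityʳ _)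
  W⁺ : Weighted (suc t) (suc q) (suc M) (comb (suc q) (suc M) a⁺)
  W⁺ = comb-weighted (suc t) (suc q) (suc M) a⁺
  d : Word n → ℚ
  d w = c (o ∷ w) - comb (suc q) (suc M) a⁺ (o ∷ w)
  -- The error starts one layer higher: at |J| = q + 1 some j of w can be exchanged for the leading
  -- o, and `Weighted-lowest` moves the comparison to a word j v, where there is no error.
  d-low : ∀ w → #o w ≡ t → #j w ℕ.< suc (suc q) → d w ≡ 0ℚ
  d-low w s (s≤s le) with ℕP.m≤n⇒m<n∨m≡n le
  ... | inj₁ lt = minus-0 (W .low (o ∷ w) (cong suc s) lt) (W⁺ .low (o ∷ w) (cong suc s) lt)
  ... | inj₂ e with v , x , p , refl ← find-j w e =
    let s′ = trans (sym (#o-≔j v x p)) (cong suc s)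
        e′ = ℕP.suc-injective (trans (sym (#j-≔j v x p)) e)
    in begin
      d w                                                ≡⟨ cong₂ _-_ (Weighted-lowest W v x p s′ e′) (Weighted-lowest W⁺ v x p s′ e′) ⟩
      c (j ∷ v) - comb (suc q) (suc M) a⁺ (j ∷ v)        ≡⟨ cong₂ _-_ (proj₂ onj v s′) (a⁺-j v) ⟩
      comb q (suc M) a v - comb q (suc M) a v            ≡⟨ ℚP.+-inverseʳ (comb q (suc M) a v) ⟩
      0ℚ                                                 ∎
  ono : ∃ λ b → ∀ w → #o w ≡ t → d w ≡ comb (suc (suc q)) M b w
  ono = spans n t (suc (suc q)) M d (inj₂ le) (weighted
    (Balanced-minus (Balanced-tail o (W .bal)) (Balanced-tail o (W⁺ .bal))) d-low
    (λ w s h → let h′ = subst (ℕ._≤ #j w) (cong suc (sym (ℕP.+-suc q M))) h in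
      minus-0 (W .high (o ∷ w) (cong suc s) h′) (W⁺ .high (o ∷ w) (cong suc s) h′)))
  -- On words o w, adding `raise M κ β` to the coefficients contributes q + 2 times the χ_{q+2}
  -- combination of β, which is exactly d. On words j w it contributes q + 1 times the χ_{q+1}
  -- combination of β, which aᵢ cancels.
  β S = proj₁ (ι-inverse (suc q)) * proj₁ ono S
  κ : ℚ
  κ = ι n - ι (suc t) - ι q
  aₒ S = a S + raise M κ β S
  aᵢ S = (- ι (suc q)) * β S
  agree-j : ∀ w → #o w ≡ suc t → c (j ∷ w) ≡ comb (suc q) (suc M) (aₒ ▹ aᵢ) (j ∷ w)
  agree-j w s = begin
    c (j ∷ w)
      ≡⟨ proj₂ onj w s ⟩
    comb q (suc M) a w
      ≡⟨ solve 3 (λ a k b → a := (a :+ k :* b) :+ (:- k) :* b) refl (comb q (suc M) a w) (ι (suc q)) (comb (suc q) M β w) ⟩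
    (comb q (suc M) a w + ι (suc q) * comb (suc q) M β w) + (- ι (suc q)) * comb (suc q) M β w
      ≡⟨ cong₂ (λ u v → (comb q (suc M) a w + u) + v)
           (comb-raise q M κ β w (cong (λ t → ι n - ι t - ι q) s)) (comb-* (suc q) M (- ι (suc q)) β w) ⟨
    (comb q (suc M) a w + comb q (suc M) (raise M κ β) w) + comb (suc q) M aᵢ w
      ≡⟨ cong (_+ comb (suc q) M aᵢ w) (comb-+ q (suc M) a (raise M κ β) w) ⟨
    comb (suc q) (suc M) (aₒ ▹ aᵢ) (j ∷ w) ∎
  agree-o : ∀ w → #o w ≡ t → c (o ∷ w) ≡ comb (suc q) (suc M) (aₒ ▹ aᵢ) (o ∷ w)
  agree-o w s = begin
    c (o ∷ w)
      ≡⟨ solve 2 (λ c e → c := e :+ (c :- e)) refl (c (o ∷ w)) (comb (suc q) (suc M) a⁺ (o ∷ w)) ⟩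
    comb (suc q) (suc M) a⁺ (o ∷ w) + d w
      ≡⟨ cong₂ _+_ (comb-o (suc q) M a⁺ w) (proj₂ ono w s) ⟩
    A + comb (suc (suc q)) M (proj₁ ono) w
      ≡⟨ cong (A +_) (comb-cong (suc (suc q)) M (λ S _ → ι-divide (suc q) (proj₁ ono S)) w) ⟨
    A + comb (suc (suc q)) M (λ S → ι (suc (suc q)) * β S) w
      ≡⟨ cong (A +_) (comb-* (suc (suc q)) M (ι (suc (suc q))) β w) ⟩
    A + ι (suc (suc q)) * comb (suc (suc q)) M β w
      ≡⟨ cong (A +_) (comb-raise (suc q) M κ β w (trans (κ-shift n (#o w) q) (cong (λ t → ι n - (1ℚ + ι t) - ι q) s))) ⟨
    A + comb (suc q) (suc M) (raise M κ β) w
      ≡⟨ comb-+ (suc q) (suc M) a (raise M κ β) w ⟨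
    comb (suc q) (suc M) aₒ w
      ≡⟨ comb-o (suc q) M (aₒ ▹ aᵢ) w ⟨
    comb (suc q) (suc M) (aₒ ▹ aᵢ) (o ∷ w) ∎
    where
    A : ℚ
    A = comb (suc q) (suc M) a w
  agree : ∀ w → #o w ≡ suc t → c w ≡ comb (suc q) (suc M) (aₒ ▹ aᵢ) w
  agree (i ∷ w) s = Balanced-i (W .bal) (comb-balanced (suc q) (suc M) (suc t) (aₒ ▹ aᵢ)) agree-j agree-o w s
  agree (j ∷ w) s = agree-j w s
  agree (o ∷ w) s = agree-o w (ℕP.suc-injective s)

-- Words and pairs of subsets

left right : ∀ {n} → Word n → Subset n
left []      = []
left (i ∷ w) = inside ∷ left w
left (j ∷ w) = outside ∷ left w
left (o ∷ w) = outside ∷ left w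
right []      = []
right (i ∷ w) = outside ∷ right w
right (j ∷ w) = inside ∷ right w
right (o ∷ w) = outside ∷ right w

-- Where I and J overlap, the letter is i; hence `left-word` holds for all pairs and disjointness
-- enters only in `right-word`.
word : ∀ {n} → Subset n → Subset n → Word n
word []            []            = []
word (inside ∷ I)  (_ ∷ J)       = i ∷ word I J
word (outside ∷ I) (inside ∷ J)  = j ∷ word I J
word (outside ∷ I) (outside ∷ J) = o ∷ word I J

left-word : ∀ {n} (I J : Subset n) → left (word I J) ≡ I
left-word []            []            = refl
left-word (inside ∷ I)  (_ ∷ J)       = cong (inside ∷_) (left-word I J)
left-word (outside ∷ I) (inside ∷ J)  = cong (outside ∷_) (left-word I J)
left-word (outside ∷ I) (outside ∷ J) = cong (outside ∷_) (left-word I J)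

right-word : ∀ {n} (I J : Subset n) → Disjoint I J → right (word I J) ≡ J
right-word []            []            _  = refl
right-word (inside ∷ I)  (inside ∷ J)  ()
right-word (inside ∷ I)  (outside ∷ J) d  = cong (outside ∷_) (right-word I J (VP.∷-injectiveʳ d))
right-word (outside ∷ I) (inside ∷ J)  d  = cong (inside ∷_) (right-word I J (VP.∷-injectiveʳ d))
right-word (outside ∷ I) (outside ∷ J) d  = cong (outside ∷_) (right-word I J (VP.∷-injectiveʳ d))

left-right-disjoint : ∀ {n} (w : Word n) → Disjoint (left w) (right w)
left-right-disjoint []      = refl
left-right-disjoint (i ∷ w) = cong (outside ∷_) (left-right-disjoint w)
left-right-disjoint (j ∷ w) = cong (outside ∷_) (left-right-disjoint w)
left-right-disjoint (o ∷ w) = cong (outside ∷_) (left-right-disjoint w)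

∣right∣ : ∀ {n} (w : Word n) → ∣ right w ∣ ≡ #j w
∣right∣ []      = refl
∣right∣ (i ∷ w) = ∣right∣ w
∣right∣ (j ∷ w) = cong suc (∣right∣ w)
∣right∣ (o ∷ w) = ∣right∣ w

sizes : ∀ {n} (w : Word n) → ∣ left w ∣ ℕ.+ #j w ℕ.+ #o w ≡ n
sizes []      = refl
sizes (i ∷ w) = cong suc (sizes w)
sizes (j ∷ w) = trans (cong (ℕ._+ #o w) (ℕP.+-suc ∣ left w ∣ (#j w))) (cong suc (sizes w))
sizes (o ∷ w) = trans (ℕP.+-suc (∣ left w ∣ ℕ.+ #j w) (#o w)) (cong suc (sizes w))

word-with-sizes : ∀ n a b → a ℕ.+ b ℕ.≤ n → ∃ λ (w : Word n) → ∣ left w ∣ ≡ a × #j w ≡ b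
word-with-sizes zero    zero    zero    _       = [] , refl , refl
word-with-sizes (suc n) zero    zero    _       =
  let w , e , e′ = word-with-sizes n 0 0 z≤n in o ∷ w , e , e′
word-with-sizes (suc n) zero    (suc b) (s≤s l) =
  let w , e , e′ = word-with-sizes n 0 b l in j ∷ w , e , cong suc e′
word-with-sizes (suc n) (suc a) b       (s≤s l) =
  let w , e , e′ = word-with-sizes n a b l in i ∷ w , cong suc e , e′

left-≔i : ∀ {n} (w : Word n) x → lookup w x ≡ o → left (w [ x ]≔ i) ≡ left w ∪ ⁅ x ⁆
left-≔i (.o ∷ w) zero    refl = cong (inside ∷_) (sym (SP.∪-identityʳ (left w)))
left-≔i (i ∷ w)  (suc x) e    = cong (inside ∷_) (left-≔i w x e)
left-≔i (j ∷ w)  (suc x) e    = cong (outside ∷_) (left-≔i w x e)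
left-≔i (o ∷ w)  (suc x) e    = cong (outside ∷_) (left-≔i w x e)

right-≔j : ∀ {n} (w : Word n) x → lookup w x ≡ o → right (w [ x ]≔ j) ≡ right w ∪ ⁅ x ⁆
right-≔j (.o ∷ w) zero    refl = cong (inside ∷_) (sym (SP.∪-identityʳ (right w)))
right-≔j (i ∷ w)  (suc x) e    = cong (outside ∷_) (right-≔j w x e)
right-≔j (j ∷ w)  (suc x) e    = cong (inside ∷_) (right-≔j w x e)
right-≔j (o ∷ w)  (suc x) e    = cong (outside ∷_) (right-≔j w x e)

left-≔j : ∀ {n} (w : Word n) x → lookup w x ≡ o → left (w [ x ]≔ j) ≡ left w
left-≔j (.o ∷ w) zero    refl = refl
left-≔j (i ∷ w)  (suc x) e    = cong (inside ∷_) (left-≔j w x e)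
left-≔j (j ∷ w)  (suc x) e    = cong (outside ∷_) (left-≔j w x e)
left-≔j (o ∷ w)  (suc x) e    = cong (outside ∷_) (left-≔j w x e)

right-≔i : ∀ {n} (w : Word n) x → lookup w x ≡ o → right (w [ x ]≔ i) ≡ right w
right-≔i (.o ∷ w) zero    refl = refl
right-≔i (i ∷ w)  (suc x) e    = cong (outside ∷_) (right-≔i w x e)
right-≔i (j ∷ w)  (suc x) e    = cong (inside ∷_) (right-≔i w x e)
right-≔i (o ∷ w)  (suc x) e    = cong (outside ∷_) (right-≔i w x e)

∣left-≔i∣ : ∀ {n} (w : Word n) x → lookup w x ≡ o → ∣ left (w [ x ]≔ i) ∣ ≡ suc ∣ left w ∣
∣left-≔i∣ (.o ∷ w) zero    refl = refl
∣left-≔i∣ (i ∷ w)  (suc x) e    = cong suc (∣left-≔i∣ w x e)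
∣left-≔i∣ (j ∷ w)  (suc x) e    = ∣left-≔i∣ w x e
∣left-≔i∣ (o ∷ w)  (suc x) e    = ∣left-≔i∣ w x e

o∉left : ∀ {n} (w : Word n) x → lookup w x ≡ o → x ∉ left w
o∉left (.o ∷ w) zero    refl ()
o∉left (i ∷ w)  (suc x) e    (there p) = o∉left w x e p
o∉left (j ∷ w)  (suc x) e    (there p) = o∉left w x e p
o∉left (o ∷ w)  (suc x) e    (there p) = o∉left w x e p

o∉right : ∀ {n} (w : Word n) x → lookup w x ≡ o → x ∉ right w
o∉right (.o ∷ w) zero    refl ()
o∉right (i ∷ w)  (suc x) e    (there p) = o∉right w x e p
o∉right (j ∷ w)  (suc x) e    (there p) = o∉right w x e p
o∉right (o ∷ w)  (suc x) e    (there p) = o∉right w x e p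

lookup-word : ∀ {n} (A B : Subset n) x → x ∉ A → x ∉ B → lookup (word A B) x ≡ o
lookup-word (inside ∷ A)  (_ ∷ B)       zero    p p′ = contradiction here p
lookup-word (outside ∷ A) (inside ∷ B)  zero    p p′ = contradiction here p′
lookup-word (outside ∷ A) (outside ∷ B) zero    p p′ = refl
lookup-word (inside ∷ A)  (_ ∷ B)       (suc x) p p′ = lookup-word A B x (p ∘ there) (p′ ∘ there)
lookup-word (outside ∷ A) (inside ∷ B)  (suc x) p p′ = lookup-word A B x (p ∘ there) (p′ ∘ there)
lookup-word (outside ∷ A) (outside ∷ B) (suc x) p p′ = lookup-word A B x (p ∘ there) (p′ ∘ there)

-- χ as an indicator function, and its extreme layers

𝟙[_] : Bool → ℚ
𝟙[ b ] = if b then 1ℚ else 0ℚ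

-- The condition |J - S| = q is written |J ∩ S| + q = |J|, which differs from the condition in `cS`
-- only by adding q to both sides.
χ-does : ∀ {n} (S : Subset n) w q →
  χ S w q ≡ 𝟙[ does (S ⊆? (left w ∪ right w)) ∧ does (∣ right w ∩ S ∣ ℕ.+ q ℕ.≟ #j w) ]
χ-does []            []      zero    = refl
χ-does []            []      (suc q) = refl
χ-does (outside ∷ S) (i ∷ w) q       = χ-does S w q
χ-does (inside ∷ S)  (i ∷ w) q       = χ-does S w q
χ-does (outside ∷ S) (j ∷ w) zero    = sym (cong 𝟙[_] (trans
  (cong (does (S ⊆? (left w ∪ right w)) ∧_)
    (dec-false (∣ right w ∩ S ∣ ℕ.+ 0 ℕ.≟ suc (#j w)) (ℕP.<⇒≢ (s≤s (subst₂ ℕ._≤_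
      (sym (ℕP.+-identityʳ _)) (∣right∣ w) (SP.∣p∩q∣≤∣p∣ (right w) S))))))
  (BP.∧-zeroʳ _)))
χ-does (outside ∷ S) (j ∷ w) (suc q) = trans (χ-does S w q)
  (cong (λ u → 𝟙[ does (S ⊆? (left w ∪ right w)) ∧ does (u ℕ.≟ suc (#j w)) ])
    (sym (ℕP.+-suc ∣ right w ∩ S ∣ q)))
χ-does (inside ∷ S)  (j ∷ w) q       = χ-does S w q
χ-does (outside ∷ S) (o ∷ w) q       = χ-does S w q
χ-does (inside ∷ S)  (o ∷ w) q       = refl

-- With |J| = q, the condition |J - S| = q makes S disjoint from J. The value no longer depends on
-- J, as balancing condition (ii) demands.
χ-lowest : ∀ {n} (S : Subset n) w q → #j w ≡ q → χ S w q ≡ 𝟙[ does (S ⊆? left w) ]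
χ-lowest []            []      zero    e = refl
χ-lowest (outside ∷ S) (i ∷ w) q       e = χ-lowest S w q e
χ-lowest (inside ∷ S)  (i ∷ w) q       e = χ-lowest S w q e
χ-lowest (outside ∷ S) (j ∷ w) (suc q) e = χ-lowest S w q (ℕP.suc-injective e)
χ-lowest (inside ∷ S)  (j ∷ w) q       e = χ-low S w q (ℕP.≤-reflexive e)
χ-lowest (outside ∷ S) (o ∷ w) q       e = χ-lowest S w q e
χ-lowest (inside ∷ S)  (o ∷ w) q       e = refl

-- With |J| = q + |S|, the condition |J - S| = q forces S ⊆ J. The value no longer depends on I, as
-- balancing condition (iii) demands.
χ-highest : ∀ {n} (S : Subset n) w q → #j w ≡ q ℕ.+ ∣ S ∣ → χ S w q ≡ 𝟙[ does (S ⊆? right w) ]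
χ-highest []            []      zero    e = refl
χ-highest (outside ∷ S) (i ∷ w) q       e = χ-highest S w q e
χ-highest (inside ∷ S)  (i ∷ w) q       e =
  χ-high S w q (ℕP.≤-reflexive (trans (sym (ℕP.+-suc q ∣ S ∣)) (sym e)))
χ-highest (outside ∷ S) (j ∷ w) zero    e = sym (cong 𝟙[_] (dec-false (S ⊆? right w) λ sub →
  ℕP.1+n≰n (subst (ℕ._≤ ∣ right w ∣) (sym (trans (cong suc (∣right∣ w)) e)) (SP.p⊆q⇒∣p∣≤∣q∣ sub))))
χ-highest (outside ∷ S) (j ∷ w) (suc q) e = χ-highest S w q (ℕP.suc-injective e)
χ-highest (inside ∷ S)  (j ∷ w) q       e = χ-highest S w q (ℕP.suc-injective (trans e (ℕP.+-suc q ∣ S ∣)))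
χ-highest (outside ∷ S) (o ∷ w) q       e = χ-highest S w q e
χ-highest (inside ∷ S)  (o ∷ w) q       e = refl

-- Enumeration of small subsets and Pascal's rule

filter-map : ∀ {A B : Set} {P : B → Set} (P? : ∀ x → Dec (P x)) (f : A → B) xs →
             filter P? (map f xs) ≡ map f (filter (P? ∘ f) xs)
filter-map P? f []       = refl
filter-map P? f (x ∷ xs) with does (P? (f x))
... | true  = cong (f x ∷_) (filter-map P? f xs)
... | false = filter-map P? f xs

basisIndex-zero : ∀ n → basisIndex (suc n) 0 ≡ map (outside ∷_) (basisIndex n 0)
basisIndex-zero n = begin
  basisIndex (suc n) 0
    ≡⟨ LP.filter-++ _ (map (outside ∷_) (allSubsets n)) _ ⟩
  filter _ (map (outside ∷_) (allSubsets n)) ++ filter _ (map (inside ∷_) (allSubsets n))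
    ≡⟨ cong₂ _++_ (filter-map _ (outside ∷_) (allSubsets n)) (filter-map _ (inside ∷_) (allSubsets n)) ⟩
  map (outside ∷_) (basisIndex n 0) ++ map (inside ∷_) (filter _ (allSubsets n))
    ≡⟨ cong (λ l → map (outside ∷_) (basisIndex n 0) ++ map (inside ∷_) l)
         (LP.filter-none (λ S → suc ∣ S ∣ ℕ.≤? 0) (All.universal (λ S ()) (allSubsets n))) ⟩
  map (outside ∷_) (basisIndex n 0) ++ []
    ≡⟨ LP.++-identityʳ _ ⟩
  map (outside ∷_) (basisIndex n 0) ∎

basisIndex-suc : ∀ n b → basisIndex (suc n) (suc b) ≡
                 map (outside ∷_) (basisIndex n (suc b)) ++ map (inside ∷_) (basisIndex n b)
basisIndex-suc n b = begin
  basisIndex (suc n) (suc b)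
    ≡⟨ LP.filter-++ _ (map (outside ∷_) (allSubsets n)) _ ⟩
  filter _ (map (outside ∷_) (allSubsets n)) ++ filter _ (map (inside ∷_) (allSubsets n))
    ≡⟨ cong₂ _++_ (filter-map _ (outside ∷_) (allSubsets n)) (filter-map _ (inside ∷_) (allSubsets n)) ⟩
  map (outside ∷_) (basisIndex n (suc b)) ++ map (inside ∷_) (filter _ (allSubsets n))
    ≡⟨ cong (λ l → map (outside ∷_) (basisIndex n (suc b)) ++ map (inside ∷_) l)
         (LP.filter-≐ (λ S → suc ∣ S ∣ ℕ.≤? suc b) (λ S → ∣ S ∣ ℕ.≤? b) (ℕ.s≤s⁻¹ , s≤s) (allSubsets n)) ⟩
  map (outside ∷_) (basisIndex n (suc b)) ++ map (inside ∷_) (basisIndex n b) ∎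

sumℚ-++ : ∀ {A : Set} (f : A → ℚ) xs ys → sumℚ f (xs ++ ys) ≡ sumℚ f xs + sumℚ f ys
sumℚ-++ f []       ys = sym (ℚP.+-identityˡ _)
sumℚ-++ f (x ∷ xs) ys = trans (cong (f x +_) (sumℚ-++ f xs ys)) (sym (ℚP.+-assoc (f x) _ _))

sumℚ-map : ∀ {A B : Set} (f : B → ℚ) (g : A → B) xs → sumℚ f (map g xs) ≡ sumℚ (f ∘ g) xs
sumℚ-map f g = LP.foldr-map (λ a acc → f a + acc) g 0ℚ

-- The bound |S| ≤ b of the list becomes the strict bound |S| < b + 1 of `∑`.
sumℚ-basisIndex : ∀ n b (f : Subset n → ℚ) → sumℚ f (basisIndex n b) ≡ ∑ (suc b) f
sumℚ-basisIndex zero    b       f = ℚP.+-identityʳ (f [])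
sumℚ-basisIndex (suc n) zero    f = begin
  sumℚ f (basisIndex (suc n) 0)                ≡⟨ cong (sumℚ f) (basisIndex-zero n) ⟩
  sumℚ f (map (outside ∷_) (basisIndex n 0))   ≡⟨ sumℚ-map f (outside ∷_) (basisIndex n 0) ⟩
  sumℚ (f ∘ (outside ∷_)) (basisIndex n 0)     ≡⟨ sumℚ-basisIndex n 0 _ ⟩
  ∑ 1 (f ∘ (outside ∷_))                       ≡⟨ ℚP.+-identityʳ _ ⟨
  ∑ 1 f                                        ∎
sumℚ-basisIndex (suc n) (suc b) f = begin
  sumℚ f (basisIndex (suc n) (suc b))
    ≡⟨ cong (sumℚ f) (basisIndex-suc n b) ⟩
  sumℚ f (map (outside ∷_) (basisIndex n (suc b)) ++ map (inside ∷_) (basisIndex n b))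
    ≡⟨ sumℚ-++ f (map (outside ∷_) (basisIndex n (suc b))) _ ⟩
  sumℚ f (map (outside ∷_) (basisIndex n (suc b))) + sumℚ f (map (inside ∷_) (basisIndex n b))
    ≡⟨ cong₂ _+_ (trans (sumℚ-map f (outside ∷_) (basisIndex n (suc b))) (sumℚ-basisIndex n (suc b) _))
                 (trans (sumℚ-map f (inside ∷_) (basisIndex n b)) (sumℚ-basisIndex n b _)) ⟩
  ∑ (suc (suc b)) f ∎

partialSum : (ℕ → ℕ) → ℕ → ℕ
partialSum f m = foldr ℕ._+_ 0 (applyUpTo f m)

partialSum-cong : ∀ {f g : ℕ → ℕ} m → (∀ x → f x ≡ g x) → partialSum f m ≡ partialSum g m
partialSum-cong zero    e = refl
partialSum-cong (suc m) e = cong₂ ℕ._+_ (e 0) (partialSum-cong m (e ∘ suc))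

partialSum-+ : ∀ (f g : ℕ → ℕ) m → partialSum (λ x → f x ℕ.+ g x) m ≡ partialSum f m ℕ.+ partialSum g m
partialSum-+ f g zero    = refl
partialSum-+ f g (suc m) = trans
  (cong (f 0 ℕ.+ g 0 ℕ.+_) (partialSum-+ (f ∘ suc) (g ∘ suc) m))
  (ℕCS.interchange (f 0) (g 0) _ _)

binomSum-partialSum : ∀ n b → binomSum n b ≡ partialSum (n C_) (suc b)
binomSum-partialSum n b = trans (sym (LP.foldr-map ℕ._+_ (n C_) 0 (upTo (suc b))))
  (cong (foldr ℕ._+_ 0) (LP.map-upTo (n C_) (suc b)))

binomSum-suc : ∀ n b → binomSum (suc n) (suc b) ≡ binomSum n (suc b) ℕ.+ binomSum n b
binomSum-suc n b = begin
  binomSum (suc n) (suc b)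
    ≡⟨ binomSum-partialSum (suc n) (suc b) ⟩
  1 ℕ.+ partialSum (λ x → suc n C suc x) (suc b)
    ≡⟨ cong suc (partialSum-cong (suc b) (λ x → sym (trans (ℕP.+-comm _ (n C x)) (nCk+nC[k+1]≡[n+1]C[k+1] n x)))) ⟩
  1 ℕ.+ partialSum (λ x → n C suc x ℕ.+ n C x) (suc b)
    ≡⟨ cong suc (partialSum-+ (λ x → n C suc x) (n C_) (suc b)) ⟩
  1 ℕ.+ (partialSum (λ x → n C suc x) (suc b) ℕ.+ partialSum (n C_) (suc b))
    ≡⟨ cong₂ ℕ._+_ (binomSum-partialSum n (suc b)) (binomSum-partialSum n b) ⟨
  binomSum n (suc b) ℕ.+ binomSum n b ∎

length-basisIndex : ∀ n b → length (basisIndex n b) ≡ binomSum n b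
length-basisIndex zero    zero    = refl
length-basisIndex zero    (suc b) = sym (trans (binomSum-partialSum 0 (suc b)) (cong suc (zeros b)))
  where
  zeros : ∀ b → partialSum (λ x → 0 C suc x) (suc b) ≡ 0
  zeros b = trans (partialSum-cong (suc b) (λ x → k>n⇒nCk≡0 {0} {suc x} z<s)) (const0 (suc b))
    where
    const0 : ∀ m → partialSum (λ _ → 0) m ≡ 0
    const0 zero    = refl
    const0 (suc m) = const0 m
length-basisIndex (suc n) zero    = trans (cong length (basisIndex-zero n))
  (trans (LP.length-map _ (basisIndex n 0)) (length-basisIndex n 0))
length-basisIndex (suc n) (suc b) = begin
  length (basisIndex (suc n) (suc b))
    ≡⟨ cong length (basisIndex-suc n b) ⟩
  length (map (outside ∷_) (basisIndex n (suc b)) ++ map (inside ∷_) (basisIndex n b))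
    ≡⟨ LP.length-++ (map (outside ∷_) (basisIndex n (suc b))) ⟩
  length (map (outside ∷_) (basisIndex n (suc b))) ℕ.+ length (map (inside ∷_) (basisIndex n b))
    ≡⟨ cong₂ ℕ._+_ (trans (LP.length-map _ (basisIndex n (suc b))) (length-basisIndex n (suc b)))
                   (trans (LP.length-map _ (basisIndex n b)) (length-basisIndex n b)) ⟩
  binomSum n (suc b) ℕ.+ binomSum n b
    ≡⟨ binomSum-suc n b ⟨
  binomSum (suc n) (suc b) ∎

-- The maximum of |I| over 𝒫_r

∈-allSubsets : ∀ {n} (S : Subset n) → S ∈ₗ allSubsets n
∈-allSubsets []            = Any.here refl
∈-allSubsets (outside ∷ S) = LM.∈-++⁺ˡ (LM.∈-map⁺ (outside ∷_) (∈-allSubsets S))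
∈-allSubsets (inside ∷ S)  = LM.∈-++⁺ʳ (map (outside ∷_) (allSubsets _)) (LM.∈-map⁺ (inside ∷_) (∈-allSubsets S))

maxI-upper : ∀ r k n b → (∀ I J → InP r k n I J → ∣ I ∣ ℕ.≤ b) → maxI r k n ℕ.≤ b
maxI-upper r k n b h = LP.foldr-preservesᵇ {P = ℕ._≤ b} ℕP.⊔-lub z≤n
  (AllP.map⁺ (All.map (λ {(I , J)} → h I J)
    (AllP.all-filter (λ p → InP? r k n (proj₁ p) (proj₂ p)) (cartesianProduct (allSubsets n) (allSubsets n)))))

maxI-lower : ∀ r k n I J → InP r k n I J → ∣ I ∣ ℕ.≤ maxI r k n
maxI-lower r k n I J p = LP.foldr-preservesᵒ {P = ∣ I ∣ ℕ.≤_} (λ x y → Sum.[ ℕP.m≤n⇒m≤n⊔o y , ℕP.m≤n⇒m≤o⊔n x ]) 0 _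
  (inj₂ (Any.map ℕP.≤-reflexive (LM.∈-map⁺ (λ p → ∣ proj₁ p ∣)
    (LM.∈-filter⁺ (λ p → InP? r k n (proj₁ p) (proj₂ p)) (LM.∈-cartesianProduct⁺ (∈-allSubsets I) (∈-allSubsets J)) p))))

-- The range of |J| on 𝒫_r

record Shape (n k r s m q L : ℕ) : Set where
  field
    n-size : s ℕ.+ suc r ≡ n
    m≤s    : m ℕ.≤ s
    L≤r    : L ℕ.≤ r
    q+L≤s  : q ℕ.+ L ℕ.≤ s
    -- The lower end q of the range of |J| comes either from |I| ≤ k - 1 or from |J| ≥ 0; the upper
    -- end q + L comes either from |J| ≤ n - k - 1 or from |J| ≤ s.
    lower  : q ℕ.+ (k ℕ.∸ 1) ≡ s ⊎ q ≡ 0 × s ℕ.≤ k ℕ.∸ 1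
    upper  : suc (q ℕ.+ L) ≡ n ℕ.∸ k ⊎ q ℕ.+ L ≡ s × s ℕ.< n ℕ.∸ k

-- Here k is one less than the parameter of the hypersimplex and N is n minus that parameter, so
-- both sides of `eq` are n - 1.
module _ (k r N s : ℕ) (k<N : k ℕ.< N) (0<r : 0 ℕ.< r) (eq : s ℕ.+ r ≡ N ℕ.+ k) where

  s≤k⊎k≤s : k ℕ.⊓ s ≡ k × k ℕ.≤ s ⊎ k ℕ.⊓ s ≡ s × s ℕ.≤ k
  s≤k⊎k≤s with ℕP.≤-total k s
  ... | inj₁ le = inj₁ (ℕP.m≤n⇒m⊓n≡m le , le)
  ... | inj₂ le = inj₂ (ℕP.m≥n⇒m⊓n≡n le , le)

  -- When |I| is as large as |I| < k and |I| ≤ s allow, the remaining |J| is still admissible, so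
  -- `maxI-value` finds that size attained.
  rest<N : s ℕ.∸ (k ℕ.⊓ s) ℕ.< N
  rest<N with s≤k⊎k≤s
  ... | inj₂ (e , le) rewrite e | ℕP.n∸n≡0 s = ℕP.≤-trans (s≤s z≤n) k<N
  ... | inj₁ (e , le) rewrite e = ℕP.+-cancelʳ-< k _ N (subst₂ ℕ._<_ (sym (ℕP.m∸n+n≡m le)) eq (ℕP.m<m+n s 0<r))

  r≤N⇒k≤s : r ℕ.≤ N → k ℕ.≤ s
  r≤N⇒k≤s le = ℕP.+-cancelʳ-≤ r k s (subst (k ℕ.+ r ℕ.≤_) (trans (ℕP.+-comm k N) (sym eq)) (ℕP.+-monoʳ-≤ k le))

maxI-value : ∀ r k n s → s ≡ n ℕ.∸ r ℕ.∸ 1 → s ℕ.∸ (k ℕ.⊓ s) ℕ.< n ℕ.∸ suc k → s ℕ.≤ n →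
             maxI r (suc k) n ≡ k ℕ.⊓ s
maxI-value r k n s refl lt s≤n =
  let w , a , b = word-with-sizes n (k ℕ.⊓ s) (s ℕ.∸ (k ℕ.⊓ s)) (subst (ℕ._≤ n) (sym split) s≤n)
      b′ = trans (∣right∣ w) b
  in ℕP.≤-antisym
    (maxI-upper r (suc k) n _ λ I J (_ , e , I<k , _) →
      ℕP.⊓-glb (ℕ.s≤s⁻¹ I<k) (subst (∣ I ∣ ℕ.≤_) e (ℕP.m≤m+n ∣ I ∣ ∣ J ∣)))
    (subst (ℕ._≤ maxI r (suc k) n) a (maxI-lower r (suc k) n (left w) (right w)
      (left-right-disjoint w , trans (cong₂ ℕ._+_ a b′) split ,
       subst (ℕ._< suc k) (sym a) (s≤s (ℕP.m⊓n≤m k s)) , subst (ℕ._< n ℕ.∸ suc k) (sym b′) lt)))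
  where
  split : k ℕ.⊓ s ℕ.+ (s ℕ.∸ (k ℕ.⊓ s)) ≡ s
  split = ℕP.m+[n∸m]≡n (ℕP.m⊓n≤n k s)

-- For r ≤ k the ends of the range come from |I| < k and |J| < n - k. For k < r < n - k only the
-- lower end does, the upper one being s. For r ≥ n - k the range is all of 0, ..., s.
shape : ∀ n k r → 2 ℕ.≤ n → 1 ℕ.≤ k → k ℕ.≤ n / 2 → 1 ℕ.≤ r → r ℕ.≤ n ℕ.∸ 1 →
  Shape n k r (n ℕ.∸ r ℕ.∸ 1) (maxI r k n) (n ℕ.∸ r ℕ.∸ 1 ℕ.∸ maxI r k n) (sizeBound r k n)
shape n@(suc n′) (suc k) (suc r) _ _ k≤n/2 _ r≤n∸1 =
  subst (λ m → Shape n (suc k) (suc r) s m (s ℕ.∸ m) (sizeBound (suc r) (suc k) n)) (sym max) cases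
  where
  s N : ℕ
  s = n ℕ.∸ suc r ℕ.∸ 1
  N = n ℕ.∸ suc k
  s-size : s ℕ.+ suc (suc r) ≡ n
  s-size = trans (cong (ℕ._+ suc (suc r)) (trans (ℕP.∸-+-assoc n (suc r) 1) (cong (n ℕ.∸_) (ℕP.+-comm (suc r) 1))))
                 (ℕP.m∸n+n≡m (s≤s r≤n∸1))
  2k≤n : suc k ℕ.+ suc k ℕ.≤ n
  2k≤n = ℕP.≤-trans (ℕP.≤-reflexive (trans (cong (suc k ℕ.+_) (sym (ℕP.+-identityʳ (suc k)))) (ℕP.*-comm 2 (suc k))))
           (ℕP.≤-trans (ℕP.*-monoˡ-≤ 2 k≤n/2) (m/n*n≤m n 2))
  k<N : k ℕ.< N
  k<N = ℕP.m+n≤o⇒m≤o∸n (suc k) 2k≤n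
  eq : s ℕ.+ suc r ≡ N ℕ.+ k
  eq = ℕP.suc-injective (begin
    suc (s ℕ.+ suc r)   ≡⟨ ℕP.+-suc s (suc r) ⟨
    s ℕ.+ suc (suc r)   ≡⟨ s-size ⟩
    n                   ≡⟨ ℕP.m∸n+n≡m (ℕP.≤-trans (ℕP.m≤m+n (suc k) (suc k)) 2k≤n) ⟨
    N ℕ.+ suc k         ≡⟨ ℕP.+-suc N k ⟩
    suc (N ℕ.+ k)       ∎)
  max : maxI (suc r) (suc k) n ≡ k ℕ.⊓ s
  max = maxI-value (suc r) k n s refl (rest<N k (suc r) N s k<N z<s eq) (subst (s ℕ.≤_) s-size (ℕP.m≤m+n s _))
  cases : Shape n (suc k) (suc r) s (k ℕ.⊓ s) (s ℕ.∸ (k ℕ.⊓ s)) (sizeBound (suc r) (suc k) n)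
  cases with suc r ℕ.≤ᵇ suc k | ℕP.≤ᵇ-reflects-≤ (suc r) (suc k)
  ... | true | ofʸ r≤k = record
    { n-size = s-size
    ; m≤s    = ℕP.m⊓n≤n k s
    ; L≤r    = ℕP.n≤1+n r
    ; q+L≤s  = ℕP.≤-trans (ℕP.+-monoʳ-≤ (s ℕ.∸ (k ℕ.⊓ s)) (ℕ.s≤s⁻¹ r≤k)) (ℕP.≤-reflexive q+k)
    ; lower  = inj₁ q+k
    ; upper  = inj₁ (ℕP.+-cancelʳ-≡ k _ N (begin
        suc (q ℕ.+ r) ℕ.+ k   ≡⟨ cong (ℕ._+ k) (sym (ℕP.+-suc q r)) ⟩
        q ℕ.+ suc r ℕ.+ k     ≡⟨ ℕCS.xy∙z≈xz∙y q (suc r) k ⟩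
        q ℕ.+ k ℕ.+ suc r     ≡⟨ cong (ℕ._+ suc r) q+k ⟩
        s ℕ.+ suc r           ≡⟨ eq ⟩
        N ℕ.+ k               ∎))
    }
    where
    q : ℕ
    q = s ℕ.∸ (k ℕ.⊓ s)
    k≤s : k ℕ.≤ s
    k≤s = r≤N⇒k≤s k (suc r) N s k<N z<s eq (ℕP.≤-trans r≤k k<N)
    q+k : s ℕ.∸ (k ℕ.⊓ s) ℕ.+ k ≡ s
    q+k = trans (cong (λ m → s ℕ.∸ m ℕ.+ k) (ℕP.m≤n⇒m⊓n≡m k≤s)) (ℕP.m∸n+n≡m k≤s)
  ... | false | ofⁿ r≰k with suc r ℕ.<ᵇ N | ℕP.<ᵇ-reflects-< (suc r) N
  ...   | true | ofʸ r<N = record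
    { n-size = s-size
    ; m≤s    = ℕP.m⊓n≤n k s
    ; L≤r    = ℕP.<⇒≤ (ℕP.<-trans (ℕP.n<1+n k) (ℕP.≰⇒> r≰k))
    ; q+L≤s  = ℕP.≤-reflexive q+k
    ; lower  = inj₁ q+k
    ; upper  = inj₂ (q+k , ℕP.+-cancelʳ-< (suc r) s N (subst (ℕ._< N ℕ.+ suc r) (sym eq)
                 (ℕP.+-monoʳ-< N (ℕP.<-trans (ℕP.n<1+n k) (ℕP.≰⇒> r≰k)))))
    }
    where
    k≤s : k ℕ.≤ s
    k≤s = r≤N⇒k≤s k (suc r) N s k<N z<s eq (ℕP.<⇒≤ r<N)
    q+k : s ℕ.∸ (k ℕ.⊓ s) ℕ.+ k ≡ s
    q+k = trans (cong (λ m → s ℕ.∸ m ℕ.+ k) (ℕP.m≤n⇒m⊓n≡m k≤s)) (ℕP.m∸n+n≡m k≤s)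
  ...   | false | ofⁿ r≮N = record
    { n-size = s-size
    ; m≤s    = ℕP.m⊓n≤n k s
    ; L≤r    = ℕP.≤-trans s≤k (ℕP.<⇒≤ (ℕP.<-trans (ℕP.n<1+n k) (ℕP.≰⇒> r≰k)))
    ; q+L≤s  = ℕP.≤-reflexive (cong (ℕ._+ s) q≡0)
    ; lower  = inj₂ (q≡0 , s≤k)
    ; upper  = inj₂ (cong (ℕ._+ s) q≡0 , ℕP.≤-<-trans s≤k k<N)
    }
    where
    s≤k : s ℕ.≤ k
    s≤k = ℕP.+-cancelʳ-≤ (suc r) s k (subst₂ ℕ._≤_ (sym eq) (ℕP.+-comm (suc r) k) (ℕP.+-monoˡ-≤ k (ℕP.≮⇒≥ r≮N)))
    q≡0 : s ℕ.∸ (k ℕ.⊓ s) ≡ 0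
    q≡0 = trans (cong (s ℕ.∸_) (ℕP.m≥n⇒m⊓n≡n s≤k)) (ℕP.n∸n≡0 s)

-- Minkowski weights

exchange⇒balance : ∀ (p p′ u u′ : ℚ) → p - p′ ≡ u - u′ → p + u′ ≡ u + p′
exchange⇒balance p p′ u u′ e = begin
  p + u′                ≡⟨ solve 3 (λ p p′ u′ → p :+ u′ := (p :- p′) :+ (p′ :+ u′)) refl p p′ u′ ⟩
  (p - p′) + (p′ + u′)  ≡⟨ cong (_+ (p′ + u′)) e ⟩
  (u - u′) + (p′ + u′)  ≡⟨ solve 3 (λ u u′ p′ → (u :- u′) :+ (p′ :+ u′) := u :+ p′) refl u u′ p′ ⟩
  u + p′                ∎

balance⇒exchange : ∀ (p p′ u u′ : ℚ) → p + u′ ≡ u + p′ → p - p′ ≡ u - u′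
balance⇒exchange p p′ u u′ e = begin
  p - p′                ≡⟨ solve 3 (λ p p′ u′ → p :- p′ := (p :+ u′) :- (p′ :+ u′)) refl p p′ u′ ⟩
  (p + u′) - (p′ + u′)  ≡⟨ cong (_- (p′ + u′)) e ⟩
  (u + p′) - (p′ + u′)  ≡⟨ solve 3 (λ u u′ p′ → (u :+ p′) :- (p′ :+ u′) := u :- u′) refl u u′ p′ ⟩
  u - u′                ∎

module _ (n k r L : ℕ)
         (sh : Shape n (suc k) r (n ∸ r ∸ 1) (maxI r (suc k) n) (n ∸ r ∸ 1 ∸ maxI r (suc k) n) L) where
  open Shape sh

  s m q N : ℕ
  s = n ∸ r ∸ 1
  m = maxI r (suc k) n
  q = s ∸ m
  N = n ∸ suc k

  -- Since |I| + |J| = s is fixed, an upper bound on |I| is a lower bound on |J|. With `window⁻`,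
  -- membership in 𝒫_r becomes q ≤ |J| ≤ q + L, the layers of `Weighted` for M = L + 1.
  window : ∀ {a b} → a ℕ.+ b ≡ s → a ℕ.< suc k → b ℕ.< N → q ℕ.≤ b × b ℕ.≤ q ℕ.+ L
  window {a} {b} e a<k b<N = lo lower , hi upper
    where
    lo : q ℕ.+ k ≡ s ⊎ q ≡ 0 × s ℕ.≤ k → q ℕ.≤ b
    lo (inj₁ e′) = ℕP.+-cancelʳ-≤ a q b (ℕP.≤-trans (ℕP.+-monoʳ-≤ q (ℕ.s≤s⁻¹ a<k))
      (ℕP.≤-reflexive (trans e′ (trans (sym e) (ℕP.+-comm a b)))))
    lo (inj₂ (e′ , _)) = subst (ℕ._≤ b) (sym e′) z≤n
    hi : suc (q ℕ.+ L) ≡ N ⊎ q ℕ.+ L ≡ s × s ℕ.< N → b ℕ.≤ q ℕ.+ L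
    hi (inj₁ e′) = ℕ.s≤s⁻¹ (subst (b ℕ.<_) (sym e′) b<N)
    hi (inj₂ (e′ , _)) = subst (b ℕ.≤_) (trans e (sym e′)) (ℕP.m≤n+m b a)

  window⁻ : ∀ {a b} → a ℕ.+ b ≡ s → q ℕ.≤ b → b ℕ.≤ q ℕ.+ L → a ℕ.< suc k × b ℕ.< N
  window⁻ {a} {b} e q≤b b≤q+L = s≤s (lo lower) , hi upper
    where
    lo : q ℕ.+ k ≡ s ⊎ q ≡ 0 × s ℕ.≤ k → a ℕ.≤ k
    lo (inj₁ e′) = ℕP.+-cancelʳ-≤ b a k (subst₂ ℕ._≤_ (trans e′ (sym e)) (ℕP.+-comm b k) (ℕP.+-monoˡ-≤ k q≤b))
    lo (inj₂ (_ , le)) = ℕP.≤-trans (ℕP.m≤m+n a b) (subst (ℕ._≤ k) (sym e) le)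
    hi : suc (q ℕ.+ L) ≡ N ⊎ q ℕ.+ L ≡ s × s ℕ.< N → b ℕ.< N
    hi (inj₁ e′) = subst (b ℕ.<_) e′ (s≤s b≤q+L)
    hi (inj₂ (e′ , lt)) = ℕP.≤-<-trans (subst (b ℕ.≤_) e′ b≤q+L) lt

  #o⇒size : ∀ w → #o w ≡ suc r → ∣ left w ∣ ℕ.+ #j w ≡ s
  #o⇒size w e = ℕP.+-cancelʳ-≡ (suc r) _ s
    (trans (trans (cong (∣ left w ∣ ℕ.+ #j w ℕ.+_) (sym e)) (sizes w)) (sym n-size))

  size⇒#o : ∀ w → ∣ left w ∣ ℕ.+ #j w ≡ s → #o w ≡ suc r
  size⇒#o w e = ℕP.+-cancelˡ-≡ s _ (suc r)
    (trans (trans (cong (ℕ._+ #o w) (sym e)) (sizes w)) (sym n-size))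

  inP⁺ : ∀ w {a b} → ∣ left w ∣ ≡ a → #j w ≡ b → a ℕ.+ b ≡ s → a ℕ.< suc k → b ℕ.< N →
         InP r (suc k) n (left w) (right w)
  inP⁺ w refl refl e a<k b<N = left-right-disjoint w ,
    trans (cong (∣ left w ∣ ℕ.+_) (∣right∣ w)) e , a<k , subst (ℕ._< N) (sym (∣right∣ w)) b<N

  inP⁻ : ∀ w {a b} → ∣ left w ∣ ≡ a → #j w ≡ b → InP r (suc k) n (left w) (right w) →
         a ℕ.+ b ≡ s × a ℕ.< suc k × b ℕ.< N
  inP⁻ w refl refl (_ , e , a<k , b<N) =
    trans (cong (∣ left w ∣ ℕ.+_) (sym (∣right∣ w))) e , a<k , subst (ℕ._< N) (∣right∣ w) b<N

  -- On 𝒫_r, |J| = s - |I| = (m - |I|) + q, so |J ∩ S| equals the level exactly when |J - S| = q.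
  -- The truncated m - |I| is a true difference because |I| ≤ m.
  cS-χ : ∀ S {I J} w → InP r (suc k) n I J → I ≡ left w → J ≡ right w → cS r (suc k) n S I J ≡ χ S w q
  cS-χ S w p refl refl = trans
    (cong (λ b → 𝟙[ does (S ⊆? (left w ∪ right w)) ∧ b ])
      (does-⇔ (mk⇔ (λ e → trans (cong (ℕ._+ q) e) (sym #j≡)) (λ e → ℕP.+-cancelʳ-≡ q _ _ (trans e #j≡)))
        (∣ right w ∩ S ∣ ℕ.≟ m ℕ.∸ ∣ left w ∣) (∣ right w ∩ S ∣ ℕ.+ q ℕ.≟ #j w)))
    (sym (χ-does S w q))
    where
    #j≡ : #j w ≡ m ℕ.∸ ∣ left w ∣ ℕ.+ q
    #j≡ = ℕP.+-cancelˡ-≡ ∣ left w ∣ _ _ (begin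
      ∣ left w ∣ ℕ.+ #j w                          ≡⟨ proj₁ (inP⁻ w refl refl p) ⟩
      s                                            ≡⟨ ℕP.m+[n∸m]≡n m≤s ⟨
      m ℕ.+ q                                      ≡⟨ cong (ℕ._+ q) (ℕP.m+[n∸m]≡n (maxI-lower r (suc k) n _ _ p)) ⟨
      ∣ left w ∣ ℕ.+ (m ℕ.∸ ∣ left w ∣) ℕ.+ q      ≡⟨ ℕP.+-assoc ∣ left w ∣ _ q ⟩
      ∣ left w ∣ ℕ.+ (m ℕ.∸ ∣ left w ∣ ℕ.+ q)      ∎)

  linComb-comb : ∀ a {I J} w → InP r (suc k) n I J → I ≡ left w → J ≡ right w →
                 linComb r (suc k) n (basisIndex n L) a I J ≡ comb q (suc L) a w
  linComb-comb a w p e e′ = trans (sumℚ-basisIndex n L _)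
    (∑-cong (suc L) (λ S _ → cong (a S *_) (cS-χ S w p e e′)))

  word-sizes : ∀ {I J} → InP r (suc k) n I J → I ≡ left (word I J) × J ≡ right (word I J) ×
               ∣ I ∣ ℕ.+ #j (word I J) ≡ s × q ℕ.≤ #j (word I J) × #j (word I J) ℕ.≤ q ℕ.+ L ×
               #j (word I J) ≡ ∣ J ∣
  word-sizes {I} {J} (d , e , I<k , J<N) =
    let l = left-word I J
        r′ = right-word I J d
        e′ = trans (sym (∣right∣ (word I J))) (cong ∣_∣ r′)
        e″ = trans (cong (∣ I ∣ ℕ.+_) e′) e
        lo , hi = window e″ I<k (subst (ℕ._< N) (sym e′) J<N)
    in sym l , sym r′ , e″ , lo , hi , e′

  cS-lowest : ∀ S {I J} → InP r (suc k) n I J → ∣ I ∣ ≡ k → cS r (suc k) n S I J ≡ 𝟙[ does (S ⊆? I) ]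
  cS-lowest S {I} {J} p e =
    let l , r′ , size , lo , _ = word-sizes p
    in trans (cS-χ S (word I J) p l r′) (trans
      (χ-lowest S (word I J) q (ℕP.≤-antisym (#j≤q (trans (cong (ℕ._+ _) (sym e)) size) lower) lo))
      (cong (λ A → 𝟙[ does (S ⊆? A) ]) (sym l)))
    where
    #j≤q : ∀ {b} → k ℕ.+ b ≡ s → q ℕ.+ k ≡ s ⊎ q ≡ 0 × s ℕ.≤ k → b ℕ.≤ q
    #j≤q {b} size (inj₁ e′) = ℕP.≤-reflexive (ℕP.+-cancelˡ-≡ k b q (trans size (trans (sym e′) (ℕP.+-comm q k))))
    #j≤q {b} size (inj₂ (_ , s≤k)) = ℕP.≤-trans (ℕP.+-cancelˡ-≤ k b 0
      (ℕP.≤-trans (ℕP.≤-reflexive size) (ℕP.≤-trans s≤k (ℕP.m≤m+n k 0)))) z≤n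

  -- The largest admissible |J| is q + L. A set S with fewer than L elements cannot reach this
  -- layer, and one with L elements falls under `χ-highest`.
  cS-highest : ∀ S {I J} → InP r (suc k) n I J → ∣ J ∣ ≡ N ℕ.∸ 1 → ∣ S ∣ ℕ.≤ L →
               cS r (suc k) n S I J ≡ (if does (∣ S ∣ ℕ.<? L) then 0ℚ else 𝟙[ does (S ⊆? J) ])
  cS-highest S {I} {J} p e S≤L =
    let l , r′ , _ , _ , hi , e′ = word-sizes p
        #j≡ = ℕP.≤-antisym hi (q+L≤ upper (trans e′ e))
    in trans (cS-χ S (word I J) p l r′) (trans (lemma #j≡)
         (cong (λ B → if does (∣ S ∣ ℕ.<? L) then 0ℚ else 𝟙[ does (S ⊆? B) ]) (sym r′)))
    where
    q+L≤ : ∀ {b} → suc (q ℕ.+ L) ≡ N ⊎ q ℕ.+ L ≡ s × s ℕ.< N → b ≡ N ℕ.∸ 1 → q ℕ.+ L ℕ.≤ b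
    q+L≤ (inj₁ e′)        e = ℕP.≤-reflexive (trans (cong ℕ.pred e′) (sym e))
    q+L≤ (inj₂ (e′ , lt)) e = subst₂ ℕ._≤_ (sym e′) (sym e) (ℕP.<⇒≤pred lt)
    lemma : #j (word I J) ≡ q ℕ.+ L →
      χ S (word I J) q ≡ (if does (∣ S ∣ ℕ.<? L) then 0ℚ else 𝟙[ does (S ⊆? right (word I J)) ])
    lemma #j≡ with ℕP.m≤n⇒m<n∨m≡n S≤L
    ... | inj₁ lt rewrite dec-true (∣ S ∣ ℕ.<? L) lt =
      χ-high S (word I J) q (subst (q ℕ.+ ∣ S ∣ ℕ.<_) (sym #j≡) (ℕP.+-monoʳ-< q lt))
    ... | inj₂ refl rewrite dec-false (∣ S ∣ ℕ.<? ∣ S ∣) (ℕP.<-irrefl refl) = χ-highest S (word I J) q #j≡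

  cS-minkowski : ∀ S → ∣ S ∣ ℕ.≤ L → IsMinkowskiWeight r (suc k) n (cS r (suc k) n S)
  cS-minkowski S S≤L =
    (λ A B x y d x∉A x∉B y∉A y∉B _ px py px′ py′ _ _ →
      let w = word A B
          l = left-word A B
          r′ = right-word A B d
          ox = lookup-word A B x x∉A x∉B
          oy = lookup-word A B y y∉A y∉B
          X z l = χ S (w [ z ]≔ l) q
          lx z oz = trans (cong (_∪ ⁅ z ⁆) (sym l)) (sym (left-≔i w z oz))
          rx z oz = trans (sym r′) (sym (right-≔i w z oz))
          lj z oz = trans (sym l) (sym (left-≔j w z oz))
          rj z oz = trans (cong (_∪ ⁅ z ⁆) (sym r′)) (sym (right-≔j w z oz))
          fi z oz p = cS-χ S (w [ z ]≔ i) p (lx z oz) (rx z oz)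
          fj z oz p = cS-χ S (w [ z ]≔ j) p (lj z oz) (rj z oz)
      in trans (cong₂ _-_ (fi x ox px) (fi y oy py))
           (trans (balance⇒exchange (X x i) (X y i) (X x j) (X y j) (χ-balance S w x y q ox oy))
             (sym (cong₂ _-_ (fj x ox px′) (fj y oy py′))))) ,
    (λ I J J′ p p′ e → trans (cS-lowest S p e) (sym (cS-lowest S p′ e))) ,
    (λ I I′ J p p′ e → trans (cS-highest S p e S≤L) (sym (cS-highest S p′ e S≤L)))

  cS-independent : ∀ a → EqOnP r (suc k) n (linComb r (suc k) n (basisIndex n L) a) (λ _ _ → 0ℚ) →
                   ∀ S → ∣ S ∣ ℕ.≤ L → a S ≡ 0ℚ
  cS-independent a z S le = independent n (suc r) q (suc L) a (inj₂ (s≤s L≤r)) (inj₂ room) vanish S (s≤s le)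
    where
    room : q ℕ.+ suc r ℕ.+ suc L ℕ.≤ suc n
    room = subst₂ ℕ._≤_
      (trans (cong suc (ℕCS.xy∙z≈xz∙y q L (suc r))) (sym (ℕP.+-suc (q ℕ.+ suc r) L))) (cong suc n-size)
      (s≤s (ℕP.+-monoˡ-≤ (suc r) q+L≤s))
    -- A relation assumed on 𝒫_r extends to every word with r + 1 letters o, since outside the range
    -- of |J| each χ_q(S) with |S| ≤ L is 0.
    vanish : ∀ w → #o w ≡ suc r → comb q (suc L) a w ≡ 0ℚ
    vanish w e with ℕP.<-≤-connex (#j w) q | ℕP.<-≤-connex (q ℕ.+ L) (#j w)
    ... | inj₁ lt | _       = comb-low q (suc L) a w lt
    ... | inj₂ _  | inj₁ lt = comb-high q (suc L) a w (subst (ℕ._≤ #j w) (sym (ℕP.+-suc q L)) lt)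
    ... | inj₂ lo | inj₂ hi =
      let size = #o⇒size w e
          a<k , b<N = window⁻ size lo hi
          p = inP⁺ w refl refl size a<k b<N
      in trans (sym (linComb-comb a w p refl refl)) (z (left w) (right w) p)

  extend : Weight n → Word n → ℚ
  extend c w = if does (InP? r (suc k) n (left w) (right w)) then c (left w) (right w) else 0ℚ

  extend-in : ∀ c {I J} w → InP r (suc k) n I J → I ≡ left w → J ≡ right w → extend c w ≡ c I J
  extend-in c w p refl refl =
    cong (λ b → if b then c (left w) (right w) else 0ℚ) (dec-true (InP? r (suc k) n (left w) (right w)) p)

  extend-out : ∀ c w → ¬ InP r (suc k) n (left w) (right w) → extend c w ≡ 0ℚ
  extend-out c w ¬p =
    cong (λ b → if b then c (left w) (right w) else 0ℚ) (dec-false (InP? r (suc k) n (left w) (right w)) ¬p)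

  module _ (c : Weight n) (mink : IsMinkowskiWeight r (suc k) n c) where

    module _ (w : Word n) (e : #o w ≡ suc (suc r)) where

      size : suc (∣ left w ∣ ℕ.+ #j w) ≡ s
      size = ℕP.+-cancelʳ-≡ (suc r) _ s (begin
        suc (∣ left w ∣ ℕ.+ #j w) ℕ.+ suc r    ≡⟨ ℕP.+-suc (∣ left w ∣ ℕ.+ #j w) (suc r) ⟨
        ∣ left w ∣ ℕ.+ #j w ℕ.+ suc (suc r)    ≡⟨ cong (∣ left w ∣ ℕ.+ #j w ℕ.+_) e ⟨
        ∣ left w ∣ ℕ.+ #j w ℕ.+ #o w           ≡⟨ sizes w ⟩
        n                                      ≡⟨ n-size ⟨
        s ℕ.+ suc r                            ∎)

      -- Replacing an o by i, or by j, yields sizes that do not depend on the position. So the two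
      -- i-terms of the balancing equation lie in 𝒫_r together or not at all, and likewise the two
      -- j-terms.
      Iok Jok : Set
      Iok = suc ∣ left w ∣ ℕ.< suc k × #j w ℕ.< N
      Jok = ∣ left w ∣ ℕ.< suc k × suc (#j w) ℕ.< N

      module _ (x : Fin n) (ox : lookup w x ≡ o) where

        inP-i : Iok → InP r (suc k) n (left w ∪ ⁅ x ⁆) (right w)
        inP-i (a , b) = subst₂ (InP r (suc k) n) (left-≔i w x ox) (right-≔i w x ox)
          (inP⁺ (w [ x ]≔ i) (∣left-≔i∣ w x ox) (#j-≔i w x ox) size a b)

        inP-j : Jok → InP r (suc k) n (left w) (right w ∪ ⁅ x ⁆)
        inP-j (a , b) = subst₂ (InP r (suc k) n) (left-≔j w x ox) (right-≔j w x ox)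
          (inP⁺ (w [ x ]≔ j) (cong ∣_∣ (left-≔j w x ox)) (#j-≔j w x ox)
            (trans (ℕP.+-suc _ _) size) a b)

        extend-i : (p : Iok) → extend c (w [ x ]≔ i) ≡ c (left w ∪ ⁅ x ⁆) (right w)
        extend-i p = extend-in c _ (inP-i p) (sym (left-≔i w x ox)) (sym (right-≔i w x ox))

        extend-j : (p : Jok) → extend c (w [ x ]≔ j) ≡ c (left w) (right w ∪ ⁅ x ⁆)
        extend-j p = extend-in c _ (inP-j p) (sym (left-≔j w x ox)) (sym (right-≔j w x ox))

        extend-i-0 : ¬ Iok → extend c (w [ x ]≔ i) ≡ 0ℚ
        extend-i-0 ¬p = extend-out c _ λ p →
          ¬p (proj₂ (inP⁻ (w [ x ]≔ i) (∣left-≔i∣ w x ox) (#j-≔i w x ox) p))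

        extend-j-0 : ¬ Jok → extend c (w [ x ]≔ j) ≡ 0ℚ
        extend-j-0 ¬p = extend-out c _ λ p →
          ¬p (proj₂ (inP⁻ (w [ x ]≔ j) (cong ∣_∣ (left-≔j w x ox)) (#j-≔j w x ox) p))

      -- If no term lies in 𝒫_r, all are 0. If only the i-terms do, |J| is maximal and (iii) equates
      -- them; if only the j-terms do, |I| is maximal and (ii) equates them. If all four do, this is
      -- (i), or commutativity when x = y.
      extend-balance : ∀ x y → lookup w x ≡ o → lookup w y ≡ o →
        extend c (w [ x ]≔ i) + extend c (w [ y ]≔ j) ≡
        extend c (w [ x ]≔ j) + extend c (w [ y ]≔ i)
      extend-balance x y ox oy
        with (suc ∣ left w ∣ ℕ.<? suc k) ×-dec (#j w ℕ.<? N) | (∣ left w ∣ ℕ.<? suc k) ×-dec (suc (#j w) ℕ.<? N)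
      ... | no ¬I | no ¬J = trans (cong₂ _+_ (extend-i-0 x ox ¬I) (extend-j-0 y oy ¬J))
                                  (sym (cong₂ _+_ (extend-j-0 x ox ¬J) (extend-i-0 y oy ¬I)))
      ... | yes I | no ¬J = begin
        extend c (w [ x ]≔ i) + extend c (w [ y ]≔ j)
          ≡⟨ cong₂ _+_ (trans (extend-i x ox I) (trans
               (proj₂ (proj₂ mink) _ _ _ (inP-i x ox I) (inP-i y oy I) (trans (∣right∣ w) J-full))
               (sym (extend-i y oy I)))) (extend-j-0 y oy ¬J) ⟩
        extend c (w [ y ]≔ i) + 0ℚ
          ≡⟨ ℚP.+-comm (extend c (w [ y ]≔ i)) 0ℚ ⟩
        0ℚ + extend c (w [ y ]≔ i)
          ≡⟨ cong (_+ extend c (w [ y ]≔ i)) (extend-j-0 x ox ¬J) ⟨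
        extend c (w [ x ]≔ j) + extend c (w [ y ]≔ i) ∎
        where
        -- The bound on |I| in `Jok` follows from the one in `Iok`, so only the bound on |J| can
        -- have failed.
        J-full : #j w ≡ N ℕ.∸ 1
        J-full = cong ℕ.pred (ℕP.≤-antisym (proj₂ I)
          (ℕP.≮⇒≥ λ lt → ¬J (ℕP.<-trans (ℕP.n<1+n _) (proj₁ I) , lt)))
      ... | no ¬I | yes J = begin
        extend c (w [ x ]≔ i) + extend c (w [ y ]≔ j)
          ≡⟨ cong₂ _+_ (extend-i-0 x ox ¬I) (trans (extend-j y oy J) (trans
               (proj₁ (proj₂ mink) _ _ _ (inP-j y oy J) (inP-j x ox J) I-full)
               (sym (extend-j x ox J)))) ⟩
        0ℚ + extend c (w [ x ]≔ j)
          ≡⟨ ℚP.+-comm 0ℚ (extend c (w [ x ]≔ j)) ⟩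
        extend c (w [ x ]≔ j) + 0ℚ
          ≡⟨ cong (extend c (w [ x ]≔ j) +_) (extend-i-0 y oy ¬I) ⟨
        extend c (w [ x ]≔ j) + extend c (w [ y ]≔ i) ∎
        where
        I-full : ∣ left w ∣ ≡ k
        I-full = ℕP.suc-injective (ℕP.≤-antisym (proj₁ J)
          (ℕP.≮⇒≥ λ lt → ¬I (lt , ℕP.<-trans (ℕP.n<1+n _) (proj₂ J))))
      ... | yes I | yes J with x FP.≟ y
      ...   | yes refl = ℚP.+-comm (extend c (w [ x ]≔ i)) _
      ...   | no x≢y = begin
        extend c (w [ x ]≔ i) + extend c (w [ y ]≔ j)
          ≡⟨ cong₂ _+_ (extend-i x ox I) (extend-j y oy J) ⟩
        c (left w ∪ ⁅ x ⁆) (right w) + c (left w) (right w ∪ ⁅ y ⁆)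
          ≡⟨ exchange⇒balance (c (left w ∪ ⁅ x ⁆) (right w)) (c (left w ∪ ⁅ y ⁆) (right w))
               (c (left w) (right w ∪ ⁅ x ⁆)) (c (left w) (right w ∪ ⁅ y ⁆)) (proj₁ mink (left w) (right w) x y (left-right-disjoint w)
               (o∉left w x ox) (o∉right w x ox) (o∉left w y oy) (o∉right w y oy) x≢y
               (inP-i x ox I) (inP-i y oy I) (inP-j x ox J) (inP-j y oy J)
               (ℕ.s≤s⁻¹ (proj₁ I)) (subst (ℕ._< N ℕ.∸ 1) (sym (∣right∣ w)) (ℕP.<⇒≤pred (proj₂ J)))) ⟩
        c (left w) (right w ∪ ⁅ x ⁆) + c (left w ∪ ⁅ y ⁆) (right w)
          ≡⟨ cong₂ _+_ (extend-j x ox J) (extend-i y oy I) ⟨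
        extend c (w [ x ]≔ j) + extend c (w [ y ]≔ i) ∎

    extend-weighted : Weighted (suc r) q (suc L) (extend c)
    extend-weighted = weighted
      (balanced λ w x y ox oy e → extend-balance w e x y ox oy)
      (λ w _ lt → extend-out c w λ p → let e , a<k , b<N = inP⁻ w refl refl p in
        ℕP.<⇒≱ lt (proj₁ (window e a<k b<N)))
      (λ w _ le → extend-out c w λ p → let e , a<k , b<N = inP⁻ w refl refl p in
        ℕP.<⇒≱ (subst (ℕ._≤ #j w) (ℕP.+-suc q L) le) (proj₂ (window e a<k b<N)))

    cS-spans : ∃ λ a → EqOnP r (suc k) n c (linComb r (suc k) n (basisIndex n L) a)
    cS-spans =
      let a , agree = spans n (suc r) q (suc L) (extend c) (inj₂ (s≤s L≤r)) extend-weighted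
      in a , λ I J p →
        let l , r′ , size , _ = word-sizes p
            w = word I J
        in begin
          c I J                                               ≡⟨ extend-in c w p l r′ ⟨
          extend c w                                          ≡⟨ agree w (size⇒#o w (trans (cong (λ A → ∣ A ∣ ℕ.+ #j w) (sym l)) size)) ⟩
          comb q (suc L) a w                                  ≡⟨ linComb-comb a w p l r′ ⟨
          linComb r (suc k) n (basisIndex n L) a I J          ∎

theorem3p1 : (n k r : ℕ) → 2 ≤ n → 1 ≤ k → k ≤ n / 2 → 1 ≤ r → r ≤ n ∸ 1 →
    (length (basisIndex n (sizeBound r k n)) ≡ binomSum n (sizeBound r k n))
    × IsBasis r k n (basisIndex n (sizeBound r k n))
theorem3p1 n zero r _ ()
theorem3p1 n (suc k) r 2≤n 1≤k k≤n/2 1≤r r≤n∸1 =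
  length-basisIndex n L ,
  (λ S S∈ → cS-minkowski n k r L sh S (size≤ S S∈)) ,
  (λ a z S S∈ → cS-independent n k r L sh a z S (size≤ S S∈)) ,
  cS-spans n k r L sh
  where
  L : ℕ
  L = sizeBound r (suc k) n
  sh : Shape n (suc k) r _ _ _ L
  sh = shape n (suc k) r 2≤n 1≤k k≤n/2 1≤r r≤n∸1
  size≤ : ∀ S → S ∈ₗ basisIndex n L → ∣ S ∣ ≤ L
  size≤ S S∈ = proj₂ (LM.∈-filter⁻ (λ S → ∣ S ∣ ℕ.≤? L) {xs = allSubsets n} S∈)
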